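{- For any two one-counter nets, the weak simulation approximants converge at level $\omega^2$, i.e. $\sqsubseteq_{\omega^2}$ equals the weak simulation preorder $\sqsubseteq$; and this does not hold earlier in general: for every ordinal $\alpha<\omega^2$ there exist one-counter nets for which $\sqsubseteq_\alpha\ne\;\sqsubseteq$.
   Context: OCN $(Q,\mathrm{Act},\delta)$ with $\delta\subseteq Q\times\mathrm{Act}\times\{ -1,0,1\}\times Q$ induces the LTS on $Q\times\mathbb N$ with $pm\xrightarrow{a}qn$ iff $(p,a,d,q)\in\delta$, $n=m+d\ge0$; relations between two nets are on the disjoint union of their LTSs. With silent action $\tau\in\mathrm{Act}$, weak steps are $\overset{\tau}{\Longrightarrow}=(\xrightarrow{\tau})^*$ and $\overset{a}{\Longrightarrow}=(\xrightarrow{\tau})^*\xrightarrow{a}(\xrightarrow{\tau})^*$ for $a\ne\tau$. Weak simulation preorder $\sqsubseteq$: largest $R$ such that $(c,c')\in R$, $c\xrightarrow{a}d$ imply some $c'\overset{a}{\Longrightarrow}d'$ with $(d,d')\in R$. Weak simulation approximants for ordinals: $\sqsubseteq_0$ is the full relation; $s\sqsubseteq_{\alpha+1}s'$ iff for all $s\xrightarrow{a}t$ there is $s'\overset{a}{\Longrightarrow}t'$ with $t\sqsubseteq_\alpha t'$; for limit $\lambda$, $\sqsubseteq_\lambda=\bigcap_{\alpha<\lambda}\sqsubseteq_\alpha$. -}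

module Defs where

open import Data.Nat using (ℕ; zero; suc)
open import Data.Fin using (Fin)
open import Data.List using (List)
open import Data.List.Membership.Propositional using (_∈_)
open import Data.Product using (Σ; ∃; _×_; _,_)
open import Data.Sum using (_⊎_; inj₁; inj₂)
open import Relation.Binary.PropositionalEquality using (_≡_; _≢_)
open import Relation.Binary.Construct.Closure.ReflexiveTransitive using (Star)
open import Function.Bundles using (_⇔_)
open import Relation.Nullary using (¬_)

data Eff : Set where
  dec zer inc : Eff

data Apply : Eff → ℕ → ℕ → Set where
  app-dec : ∀ {n} → Apply dec (suc n) n
  app-zer : ∀ {m} → Apply zer m m
  app-inc : ∀ {m} → Apply inc m (suc m)

record OCN (nA : ℕ) : Set where
  field
    states : ℕ
    δ      : List (Fin states × Fin nA × Eff × Fin states)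

open OCN public

Conf : ∀ {nA} → OCN nA → Set
Conf N = Fin (states N) × ℕ

data Step {nA} (N : OCN nA) : Conf N → Fin nA → Conf N → Set where
  step : ∀ {p a d q m n} → (p , a , d , q) ∈ δ N → Apply d m n →
         Step N (p , m) a (q , n)

UConf : ∀ {nA} → OCN nA → OCN nA → Set
UConf N₁ N₂ = Conf N₁ ⊎ Conf N₂

data UStep {nA} (N₁ N₂ : OCN nA) : UConf N₁ N₂ → Fin nA → UConf N₁ N₂ → Set where
  left  : ∀ {c a d} → Step N₁ c a d → UStep N₁ N₂ (inj₁ c) a (inj₁ d)
  right : ∀ {c a d} → Step N₂ c a d → UStep N₁ N₂ (inj₂ c) a (inj₂ d)

module WeakSim {nA : ℕ} (τ : Fin nA) (N₁ N₂ : OCN nA) where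

  C : Set
  C = UConf N₁ N₂

  _—[_]→_ : C → Fin nA → C → Set
  s —[ a ]→ t = UStep N₁ N₂ s a t

  τ* : C → C → Set
  τ* = Star (λ s t → s —[ τ ]→ t)

  data _⇒[_]_ : C → Fin nA → C → Set where
    silent  : ∀ {s t} → τ* s t → s ⇒[ τ ] t
    visible : ∀ {a s s₁ t₁ t} → a ≢ τ → τ* s s₁ → s₁ —[ a ]→ t₁ → τ* t₁ t →
              s ⇒[ a ] t

  Rel : Set₁
  Rel = C → C → Set

  F : Rel → Rel
  F R s s′ = ∀ a t → s —[ a ]→ t → ∃ λ t′ → (s′ ⇒[ a ] t′) × R t t′

  IsWeakSimulation : Rel → Set
  IsWeakSimulation R = ∀ s s′ → R s s′ → F R s s′

  _⊑_ : C → C → Set₁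
  s ⊑ s′ = Σ Rel λ R → IsWeakSimulation R × R s s′

  -- Approximants ⊑_α for α < ω², α = ω·k + n  (Approx k n),
  -- and Below k = ⊑_{ω·k} = ⋂_{α < ω·k} ⊑_α  (full relation for k = 0).
  Full : Rel
  Full _ _ = Data.Unit.⊤
    where import Data.Unit

  mutual
    Below : ℕ → Rel
    Below zero    s s′ = Full s s′
    Below (suc k) s s′ = Below k s s′ × (∀ m → Approx k m s s′)

    Approx : ℕ → ℕ → Rel
    Approx k zero    = Below k
    Approx k (suc n) = F (Approx k n)

  ApproxOmega² : Rel
  ApproxOmega² s s′ = ∀ k n → Approx k n s s′

{-# OPTIONS --safe #-}

-- Positions of the weak simulation game are (r , m , n) with r a pair of control states and
-- m, n the counters of Spoiler and Duplicator; winning is antitone in m and monotone in n.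
--
-- Convergence.  For each r the set of m such that some n survives at level ω·k shrinks with
-- k and is an initial segment of ℕ, so it is constant from some k on.  For that k, ⊑_{ω(k+1)}
-- is a simulation: a response that can reach arbitrarily large counters needs only some
-- winning n, and all other responses offer finitely many choices.
--
-- Constructively one needs a simulation with computable responses, whereas the argument above
-- uses excluded middle.  It is therefore carried out in the continuation monad whose answer
-- type is the goal s ⊑ s′ (Friedman's A-translation), and its result is turned into a finite
-- certificate: the frontier of winning positions is eventually periodic.  To see this, let Q
-- be divisible by the Spoiler-effect of every simple cycle, and for j = 0, 1, 2, … play the
-- game until the first repetition of a pair r, where Duplicator wants the cycle (x , y) to
-- satisfy Q·y − j·x ≥ 0 or to enter a pair that he wins for a smaller j.  If he wins first for
-- j, then the frontier of r stays at bounded distance from the line of slope j/Q: forgetting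
-- cycles, his strategy keeps Q·n − j·m bounded below, while below the line Spoiler drives
-- the play away from it until his counter is so large that the strategies for smaller j win.
-- By the pigeonhole principle two columns m₁ < m₂ carry the same distances, and the part of
-- the frontier between them can be repeated forever.
--
-- Lower bound.  A tower of counting states separated by silent pumping states has rank
-- ω·(k+1), although Spoiler can repeat a single action forever.
module Submission where

open import Defs
open import Level using (Level; _⊔_; Lift; lift)
open import Data.Nat as ℕ using (ℕ; zero; suc; z≤n; s≤s; _!)
import Data.Nat.Properties as ℕ
import Data.Nat.Divisibility as ℕ
open import Data.Nat.Divisibility using (divides)
open import Data.Nat.Induction using (<-rec; <-wellFounded)
import Data.Nat.Tactic.RingSolver as ℕ using (solve-∀)
open import Data.Integer as ℤ using (ℤ; +_; -[1+_]; 0ℤ; 1ℤ; -1ℤ; ∣_∣)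
import Data.Integer.Properties as ℤ
open import Data.Integer.Tactic.RingSolver using (solve-∀)
open import Data.Fin using (Fin; zero; suc; toℕ; fromℕ; fromℕ<; inject₁; _↑ˡ_; _↑ʳ_; join; splitAt; combine; remQuot; funToFin; finToFun)
import Data.Fin.Properties as Fin
open import Data.Bool using (Bool; true; false)
open import Data.Maybe using (Maybe; just; nothing)
open import Data.Maybe.Properties using (just-injective)
open import Data.Vec as Vec using (Vec; []; _∷_; replicate; _[_]≔_)
open import Data.Vec.Properties using (lookup∘update; lookup∘update′; lookup-replicate)
open import Data.List as List using (List; []; _∷_; _++_; length; tabulate)
open import Data.List.Membership.Propositional using (_∈_)
open import Data.List.Membership.Propositional.Properties using (∈-lookup; ∈-++⁺ˡ; ∈-++⁺ʳ; ∈-++⁻; ∈-tabulate⁺; ∈-tabulate⁻)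
open import Data.List.Relation.Unary.Any using (here; there; index)
open import Data.List.Relation.Unary.Any.Properties using (lookup-index)
open import Data.Product using (Σ; _×_; _,_; proj₁; proj₂)
open import Data.Sum using (_⊎_; inj₁; inj₂; [_,_]′; map₂; swap)
open import Data.Unit using (⊤; tt)
open import Data.Empty using (⊥; ⊥-elim)
open import Function.Bundles using (_⇔_; mk⇔; Equivalence)
open import Induction.WellFounded using (Acc; acc)
open import Relation.Nullary using (¬_; yes; no)
open import Relation.Binary.PropositionalEquality using (_≡_; refl; sym; trans; cong; cong₂; subst; subst₂)
open import Relation.Binary.Construct.Closure.ReflexiveTransitive using (ε; _◅_; _◅◅_; gmap)

-- The continuation monad with answer type `A`.

module Classical {ℓ₀} (A : Set ℓ₀) where

  private variable
    ℓ ℓ′ : Level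
    X : Set ℓ
    Y : Set ℓ′

  T : ∀ {ℓ} → Set ℓ → Set (ℓ ⊔ ℓ₀)
  T X = (X → A) → A

  return : X → T X
  return x k = k x

  _>>=_ : T X → (X → T Y) → T Y
  (t >>= f) k = t (λ x → f x k)

  infixl 1 _>>=_

  orElse : X ⊎ A → T X
  orElse (inj₁ x) = return x
  orElse (inj₂ a) _ = a

  -- `X → A` acts as the negation of `X`: the refutation is offered first, and applying it to a
  -- witness re-enters the continuation with that witness.
  lem : (X : Set ℓ) → T (X ⊎ (X → A))
  lem X k = k (inj₂ (λ x → k (inj₁ x)))

  -- Double-negation shift for a finite index set. Its finiteness is why the extraction reduces
  -- everything to finitely many statements.
  ∀T-Fin : ∀ n {P : Fin n → Set ℓ} → (∀ i → T (P i)) → T (∀ i → P i)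
  ∀T-Fin zero    f = return λ ()
  ∀T-Fin (suc n) f = f zero >>= λ p → ∀T-Fin n (λ i → f (suc i)) >>= λ ps →
    return λ { zero → p ; (suc i) → ps i }

  ∀T-≤ : ∀ b {P : ℕ → Set ℓ} → (∀ m → T (P m)) → T (∀ m → m ℕ.≤ b → P m)
  ∀T-≤ zero    f = f 0 >>= λ p → return λ { .0 z≤n → p }
  ∀T-≤ (suc b) f = f 0 >>= λ p → ∀T-≤ b (λ m → f (suc m)) >>= λ ps →
    return λ { zero _ → p ; (suc m) (s≤s m≤b) → ps m m≤b }

  choice-≤ : ∀ b {X : Set ℓ} {P : ℕ → X → Set ℓ′} → (∀ m → T (Σ X (P m))) →
             T (Σ (ℕ → X) λ f → ∀ m → m ℕ.≤ b → P m (f m))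
  choice-≤ zero    f = f 0 >>= λ (x , p) → return ((λ _ → x) , λ { .0 z≤n → p })
  choice-≤ (suc b) f = f 0 >>= λ (x , p) → choice-≤ b (λ m → f (suc m)) >>= λ (g , ps) →
    return ((λ { zero → x ; (suc m) → g m }) , λ { zero _ → p ; (suc m) (s≤s m≤b) → ps m m≤b })

-- Finite maxima and counter effects.

maxF : ∀ {n} → (Fin n → ℕ) → ℕ
maxF {zero}  f = 0
maxF {suc n} f = f zero ℕ.⊔ maxF (λ i → f (suc i))

≤maxF : ∀ {n} (f : Fin n → ℕ) i → f i ℕ.≤ maxF f
≤maxF f zero    = ℕ.m≤m⊔n _ _
≤maxF f (suc i) = ℕ.≤-trans (≤maxF (λ i → f (suc i)) i) (ℕ.m≤n⊔m (f zero) _)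

apply-mono : ∀ {d m m₁ m′} → Apply d m m₁ → m ℕ.≤ m′ → Σ ℕ λ m₁′ → Apply d m′ m₁′ × m₁ ℕ.≤ m₁′
apply-mono app-dec (s≤s le) = _ , app-dec , le
apply-mono app-zer le       = _ , app-zer , le
apply-mono app-inc le       = _ , app-inc , s≤s le

apply-shift : ∀ {d m m′} i → Apply d m m′ → Apply d (m ℕ.+ i) (m′ ℕ.+ i)
apply-shift i app-dec = app-dec
apply-shift i app-zer = app-zer
apply-shift i app-inc = app-inc

apply? : ∀ d m → (Σ ℕ λ m′ → Apply d m m′) ⊎ (∀ m′ → ¬ Apply d m m′)
apply? dec zero    = inj₂ λ _ ()
apply? dec (suc m) = inj₁ (_ , app-dec)
apply? zer m       = inj₁ (_ , app-zer)
apply? inc m       = inj₁ (_ , app-inc)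

apply-unique : ∀ {d m m₁ m₂} → Apply d m m₁ → Apply d m m₂ → m₁ ≡ m₂
apply-unique app-dec app-dec = refl
apply-unique app-zer app-zer = refl
apply-unique app-inc app-inc = refl

-- Simulation games on pairs of counters.

-- A position (r , m , n) of the simulation game consists of a pair r of control states,
-- Spoiler's counter m and Duplicator's counter n.  Rsp relates Duplicator's counters
-- before and after a weak response to Spoiler's move μ that leads to the pair r′.
record Game : Set₁ where
  field
    N     : ℕ
    moves : Fin N → ℕ
    eff   : ∀ r → Fin (moves r) → Eff
    Rsp   : ∀ r → Fin (moves r) → Fin N → ℕ → ℕ → Set
    shift : ∀ {r μ r′ n n′} i → Rsp r μ r′ n n′ → Rsp r μ r′ (i ℕ.+ n) (i ℕ.+ n′)
    K     : ℕ

  Unbounded : ∀ r → Fin (moves r) → Fin N → ℕ → Set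
  Unbounded r μ r′ n = ∀ i → Σ ℕ λ n′ → i ℕ.≤ n′ × Rsp r μ r′ n n′

  field
    -- Weak responses can be infinitely many; this dichotomy makes them manageable: a gain above `K`
    -- is possible only where arbitrarily large counters can be reached in the same pair.
    gain  : ∀ {r μ r′ n n′} → Rsp r μ r′ n n′ → n′ ℕ.≤ n ℕ.+ K ⊎ Unbounded r μ r′ n

  Sim : (Fin N → ℕ → ℕ → Set) → Set
  Sim R = ∀ r m n → R r m n → ∀ μ m′ → Apply (eff r μ) m m′ →
          Σ (Fin N) λ r′ → Σ ℕ λ n′ → Rsp r μ r′ n n′ × R r′ m′ n′

  shift-≤ : ∀ {r μ r′ n n′ k} → n ℕ.≤ k → Rsp r μ r′ n n′ →
            Σ ℕ λ k′ → Rsp r μ r′ k k′ × k ℕ.+ n′ ≡ k′ ℕ.+ n × n′ ℕ.≤ k′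
  shift-≤ {r} {μ} {r′} {n} {n′} {k} n≤k ρ = i ℕ.+ n′ , subst (λ z → Rsp r μ r′ z (i ℕ.+ n′)) eq (shift i ρ) , eq′ , ℕ.m≤n+m n′ i
    where
    i : ℕ
    i = k ℕ.∸ n
    eq : i ℕ.+ n ≡ k
    eq = ℕ.m∸n+n≡m n≤k
    eq′ : k ℕ.+ n′ ≡ i ℕ.+ n′ ℕ.+ n
    eq′ = trans (cong (ℕ._+ n′) (sym eq)) (trans (ℕ.+-assoc i n n′) (trans (cong (i ℕ.+_) (ℕ.+-comm n n′)) (sym (ℕ.+-assoc i n′ n))))

  unbounded-mono : ∀ {r μ r′ n k} → n ℕ.≤ k → Unbounded r μ r′ n → Unbounded r μ r′ k
  unbounded-mono n≤k un i with un i
  ... | n′ , i≤n′ , ρ with shift-≤ n≤k ρ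
  ... | k′ , ρ′ , _ , n′≤k′ = k′ , ℕ.≤-trans i≤n′ n′≤k′ , ρ′

-- Approximants of the game and the level at which they stabilise.

module Approximants (G : Game) (A : Set₁) where
  open Game G
  open Classical A

  Rel₁ : Set₂
  Rel₁ = Fin N → ℕ → ℕ → Set₁

  _⊆_ : Rel₁ → Rel₁ → Set₁
  R ⊆ S = ∀ {r m n} → R r m n → S r m n

  -- Asking for the response only under `T` makes every approximant stable under `T`.
  F : Rel₁ → Rel₁
  F R r m n = ∀ μ {m′} → Apply (eff r μ) m m′ →
              T (Σ (Fin N) λ r′ → Σ ℕ λ n′ → Rsp r μ r′ n n′ × R r′ m′ n′)

  mutual
    Below : ℕ → Rel₁
    Below zero    r m n = Lift _ ⊤
    Below (suc k) r m n = Below k r m n × (∀ j → Apx k j r m n)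

    Apx : ℕ → ℕ → Rel₁
    Apx k zero    = Below k
    Apx k (suc j) = F (Apx k j)

  F-mono : ∀ {R S : Rel₁} → R ⊆ S → F R ⊆ F S
  F-mono R⊆S f μ ap = f μ ap >>= λ (r′ , n′ , ρ , x) → return (r′ , n′ , ρ , R⊆S x)

  Closed : Rel₁ → Set₁
  Closed R = ∀ {r m n m′ n′} → m′ ℕ.≤ m → n ℕ.≤ n′ → R r m n → R r m′ n′

  F-closed : ∀ {R} → Closed R → Closed (F R)
  F-closed cl m′≤m n≤n′ f μ ap with apply-mono ap m′≤m
  ... | _ , ap′ , le = f μ ap′ >>= λ (r′ , k , ρ , x) →
        let (k′ , ρ′ , _ , k≤k′) = shift-≤ n≤n′ ρ in return (r′ , k′ , ρ′ , cl le k≤k′ x)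

  mutual
    Below-closed : ∀ k → Closed (Below k)
    Below-closed zero    _ _ _ = lift tt
    Below-closed (suc k) p q (b , f) = Below-closed k p q b , λ j → Apx-closed k j p q (f j)

    Apx-closed : ∀ k j → Closed (Apx k j)
    Apx-closed k zero    = Below-closed k
    Apx-closed k (suc j) = F-closed (Apx-closed k j)

  mutual
    Below-stable : ∀ k {r m n} → T (Below k r m n) → Below k r m n
    Below-stable zero    t = lift tt
    Below-stable (suc k) t = Below-stable k (t >>= λ x → return (proj₁ x)) ,
                             λ j → Apx-stable k j (t >>= λ x → return (proj₂ x j))

    Apx-stable : ∀ k j {r m n} → T (Apx k j r m n) → Apx k j r m n
    Apx-stable k zero    t = Below-stable k t
    Apx-stable k (suc j) t = λ μ ap → t >>= λ f → f μ ap

  mutual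
    F-Below : ∀ k → F (Below k) ⊆ Below k
    F-Below zero    f = lift tt
    F-Below (suc k) f = F-Below k (F-mono proj₁ f) ,
      λ { zero → F-Below k (F-mono proj₁ f) ; (suc j) → F-mono (λ x → proj₂ x j) f }

    Apx-pred : ∀ k j → Apx k (suc j) ⊆ Apx k j
    Apx-pred k zero    = F-Below k
    Apx-pred k (suc j) = F-mono (Apx-pred k j)

  Apx-antitone : ∀ k {i j} → i ℕ.≤ j → Apx k j ⊆ Apx k i
  Apx-antitone k {i} {j} i≤j x = go (j ℕ.∸ i) (subst (λ z → Apx k z _ _ _) (sym (ℕ.m∸n+n≡m i≤j)) x)
    where
    go : ∀ d {r m n} → Apx k (d ℕ.+ i) r m n → Apx k i r m n
    go zero    x = x
    go (suc d) x = go d (Apx-pred k (d ℕ.+ i) x)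

  Below-antitone : ∀ {k l} → k ℕ.≤ l → Below l ⊆ Below k
  Below-antitone {k} {l} k≤l x = go (l ℕ.∸ k) (subst (λ z → Below z _ _ _) (sym (ℕ.m∸n+n≡m k≤l)) x)
    where
    go : ∀ d {r m n} → Below (d ℕ.+ k) r m n → Below k r m n
    go zero    x = x
    go (suc d) x = go d (proj₁ x)

  Dom : ℕ → Fin N → ℕ → Set₁
  Dom k r m = Σ ℕ λ n → Below k r m n

  Stabilises : Fin N → ℕ → Set₁
  Stabilises r K₀ = ∀ k m → K₀ ℕ.≤ k → Dom K₀ r m → T (Dom k r m)

  -- A failure of Dom at m bounds its extent by m, and every later loss lowers that bound.
  stabilise : ∀ r → T (Σ ℕ (Stabilises r))
  stabilise r = lem (Σ ℕ λ m → Σ ℕ λ k → Dom k r m → A) >>= λ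
    { (inj₁ (m , k , ¬d)) → <-rec P descend m k ¬d
    ; (inj₂ ¬e)           → return (0 , λ k m _ _ κ → ¬e (m , k , κ)) }
    where
    P : ℕ → Set₁
    P m = ∀ k → (Dom k r m → A) → T (Σ ℕ (Stabilises r))
    descend : ∀ m → (∀ {m′} → m′ ℕ.< m → P m′) → P m
    descend m rec k ¬d = lem (Σ ℕ λ m′ → Σ ℕ λ l → k ℕ.≤ l × Dom k r m′ × (Dom l r m′ → A)) >>= λ
      { (inj₂ ¬e) → return (k , λ l m′ k≤l d κ → ¬e (m′ , l , k≤l , d , κ))
      ; (inj₁ (m′ , l , _ , (n , b) , ¬d′)) → [ (λ m≤m′ _ → ¬d (n , Below-closed k m≤m′ ℕ.≤-refl b)) ,
                                               (λ m′<m → rec m′<m l ¬d′) ]′ (ℕ.≤-<-connex m m′) }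

  stable-level : T (Σ ℕ λ k → ∀ r m → Dom k r m → T (Dom (suc k) r m))
  stable-level = ∀T-Fin N stabilise >>= λ s → let k = maxF (λ r → proj₁ (s r)) in
    return (k , λ r m (n , b) → let k≤ = ≤maxF (λ r → proj₁ (s r)) r in
      proj₂ (s r) (suc k) m (ℕ.m≤n⇒m≤1+n k≤) (n , Below-antitone k≤ b))

  module StableLevel (k : ℕ) (stable : ∀ r m → Dom k r m → T (Dom (suc k) r m)) where

    W : Rel₁
    W = Below (suc k)

    W-closed : Closed W
    W-closed = Below-closed (suc k)

    -- For one target pair r′ finitely many counter values matter, unless the response is
    -- unbounded, in which case stability turns a win at level ωk into one at level ω(k+1).
    W-sim : W ⊆ F W
    W-sim {r} {m} {n} (b , f) μ {m′} ap ¬g =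
      (∀T-Fin N fails >>= λ js → f (suc (maxF (λ r′ → proj₁ (js r′)))) μ ap >>= λ (r′ , n′ , ρ , x) _ →
        proj₂ (js r′) n′ ρ (Apx-antitone k (≤maxF (λ r′ → proj₁ (js r′)) r′) x)) ¬g
      where
      Fails : Fin N → ℕ → Set₁
      Fails r′ j = ∀ n′ → Rsp r μ r′ n n′ → Apx k j r′ m′ n′ → A

      fails-at : ∀ r′ n′ → T (Σ ℕ λ j → Rsp r μ r′ n n′ → Apx k j r′ m′ n′ → A)
      fails-at r′ n′ = lem (Σ ℕ λ j → Apx k j r′ m′ n′ → A) >>= λ
        { (inj₁ (j , ¬x)) → return (j , λ _ → ¬x)
        ; (inj₂ ¬e) → return (0 , λ ρ b → ¬g (r′ , n′ , ρ , b , λ j → Apx-stable k j λ κ → ¬e (j , κ))) }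

      fails : ∀ r′ → T (Σ ℕ (Fails r′))
      fails r′ = lem (Unbounded r μ r′ n) >>= λ
        { (inj₁ un) → return (0 , λ n′ ρ b → stable r′ m′ (n′ , b) λ (l , c) →
            let (l′ , l≤l′ , ρ′) = un l in ¬g (r′ , l′ , ρ′ , W-closed ℕ.≤-refl l≤l′ c))
        ; (inj₂ bd) → choice-≤ (n ℕ.+ K) (fails-at r′) >>= λ (g , h) →
            let J = maxF {suc (n ℕ.+ K)} (λ i → g (toℕ i)) in
            return (J , λ n′ ρ x → [ (λ le → h n′ le ρ (Apx-antitone k (bound g n′ le) x)) , bd ]′ (gain ρ)) }
        where
        bound : ∀ {b} (g : ℕ → ℕ) n′ → n′ ℕ.≤ b → g n′ ℕ.≤ maxF {suc b} (λ i → g (toℕ i))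
        bound {b} g n′ le = subst (λ z → g z ℕ.≤ maxF {suc b} (λ i → g (toℕ i)))
          (Fin.toℕ-fromℕ< (s≤s le)) (≤maxF (λ i → g (toℕ i)) (fromℕ< (s≤s le)))

    -- Coinduction up to `W`: by `W-sim` the union of `R` and `W` is a post-fixed point of `F`,
    -- hence contained in every approximant.
    W-greatest : (R : Rel₁) → R ⊆ F (λ r m n → R r m n ⊎ W r m n) → R ⊆ W
    W-greatest R post x = below (suc k) (inj₁ x)
      where
      RW : Rel₁
      RW r m n = R r m n ⊎ W r m n
      RW-post : RW ⊆ F RW
      RW-post (inj₁ x) = post x
      RW-post (inj₂ w) = F-mono inj₂ (W-sim w)
      mutual
        below : ∀ l → RW ⊆ Below l
        below zero    x = lift tt
        below (suc l) x = below l x , λ j → apx l j x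
        apx : ∀ l j → RW ⊆ Apx l j
        apx l zero    = below l
        apx l (suc j) x = F-mono (apx l j) (RW-post x)

-- Integer inequalities and linear functionals of the two counters.

≤-by : ∀ {x y u v} → x ℤ.≤ y → v ℤ.- u ≡ y ℤ.- x → u ℤ.≤ v
≤-by x≤y eq = ℤ.0≤i-j⇒j≤i (subst (0ℤ ℤ.≤_) (sym eq) (ℤ.i≤j⇒0≤j-i x≤y))

infixl 5 _⊞_
-- Hypotheses are added up with `⊞`; `≤-by` then leaves only an identity between differences to the
-- ring solver.
_⊞_ : ∀ {x y x′ y′} → x ℤ.≤ y → x′ ℤ.≤ y′ → x ℤ.+ x′ ℤ.≤ y ℤ.+ y′
_⊞_ = ℤ.+-mono-≤

-- Here `x` belongs to Spoiler and `y` to Duplicator. The coefficient of `y` is a natural number, so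
-- a worse response never raises the value.
lin : ℕ → ℤ → ℤ → ℤ → ℤ
lin c e x y = + c ℤ.* y ℤ.+ e ℤ.* x

lin-+ : ∀ c e x y x′ y′ → lin c e (x ℤ.+ x′) (y ℤ.+ y′) ≡ lin c e x y ℤ.+ lin c e x′ y′
lin-+ c = go (+ c)
  where
  go : ∀ c e x y x′ y′ → c ℤ.* (y ℤ.+ y′) ℤ.+ e ℤ.* (x ℤ.+ x′) ≡ (c ℤ.* y ℤ.+ e ℤ.* x) ℤ.+ (c ℤ.* y′ ℤ.+ e ℤ.* x′)
  go = solve-∀

lin-- : ∀ c e x y x′ y′ → lin c e (x ℤ.- x′) (y ℤ.- y′) ≡ lin c e x y ℤ.- lin c e x′ y′
lin-- c = go (+ c)
  where
  go : ∀ c e x y x′ y′ → c ℤ.* (y ℤ.- y′) ℤ.+ e ℤ.* (x ℤ.- x′) ≡ (c ℤ.* y ℤ.+ e ℤ.* x) ℤ.- (c ℤ.* y′ ℤ.+ e ℤ.* x′)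
  go = solve-∀

lin-0 : ∀ c e → lin c e 0ℤ 0ℤ ≡ 0ℤ
lin-0 c e = cong₂ ℤ._+_ (ℤ.*-zeroʳ (+ c)) (ℤ.*-zeroʳ e)

i≤∣i∣ : ∀ i → i ℤ.≤ + ∣ i ∣
i≤∣i∣ (+ n)    = ℤ.≤-refl
i≤∣i∣ -[1+ n ] = ℤ.-≤+

-∣i∣≤i : ∀ i → ℤ.- (+ ∣ i ∣) ℤ.≤ i
-∣i∣≤i i = subst (ℤ.- (+ ∣ i ∣) ℤ.≤_) (ℤ.neg-involutive i)
  (ℤ.neg-mono-≤ (subst (λ z → ℤ.- i ℤ.≤ + z) (ℤ.∣-i∣≡∣i∣ i) (i≤∣i∣ (ℤ.- i))))

lin-bound : ∀ c e {x y X Y} → ∣ x ∣ ℕ.≤ X → ∣ y ∣ ℕ.≤ Y → ∣ lin c e x y ∣ ℕ.≤ c ℕ.* Y ℕ.+ ∣ e ∣ ℕ.* X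
lin-bound c e {x} {y} hx hy = ℕ.≤-trans (ℤ.∣i+j∣≤∣i∣+∣j∣ (+ c ℤ.* y) (e ℤ.* x))
  (ℕ.+-mono-≤ (ℕ.≤-trans (ℕ.≤-reflexive (ℤ.abs-* (+ c) y)) (ℕ.*-monoʳ-≤ c hy))
              (ℕ.≤-trans (ℕ.≤-reflexive (ℤ.abs-* e x)) (ℕ.*-monoʳ-≤ ∣ e ∣ hx)))

effect : Eff → ℤ
effect dec = -1ℤ
effect zer = 0ℤ
effect inc = 1ℤ

effect-bound : ∀ d → ∣ effect d ∣ ℕ.≤ 1
effect-bound dec = s≤s z≤n
effect-bound zer = z≤n
effect-bound inc = s≤s z≤n

apply-effect : ∀ {d m m′} → Apply d m m′ → + m′ ≡ + m ℤ.+ effect d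
apply-effect {m = suc m} app-dec = refl
apply-effect {m = m} app-zer = sym (ℤ.+-identityʳ (+ m))
apply-effect {m = m} app-inc = cong +_ (ℕ.+-comm 1 m)

-- Lines of rational slope and simple cycles.

slope : ℕ → ℕ → ℤ → ℤ → ℤ
slope Q j = lin Q (ℤ.- (+ j))

-- The slope of a cycle with first component x is a multiple of 1/Q as soon as x divides Q,
-- so no such slope lies strictly between j/Q and (j+1)/Q.
module Adjacent (X : ℕ) where

  Q : ℕ
  Q = X !

  private
    ∣Q : ∀ a → suc a ℕ.≤ X → Σ ℕ λ c → Q ≡ c ℕ.* suc a
    ∣Q a le with ℕ.∣-trans (ℕ.m∣m*n {suc a} (a !)) (ℕ.m≤n⇒m!∣n! le)
    ... | divides c eq = c , eq

    pos : ∀ {Q} c j a y → Q ≡ c ℤ.* a → Q ℤ.* y ℤ.+ ℤ.- j ℤ.* a ≡ a ℤ.* (c ℤ.* y ℤ.- j)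
    pos c j a y refl = go c j a y
      where
      go : ∀ c j a y → c ℤ.* a ℤ.* y ℤ.+ ℤ.- j ℤ.* a ≡ a ℤ.* (c ℤ.* y ℤ.- j)
      go = solve-∀

    neg : ∀ {Q} c j a y → Q ≡ c ℤ.* a → Q ℤ.* y ℤ.+ ℤ.- j ℤ.* (ℤ.- a) ≡ a ℤ.* (c ℤ.* y ℤ.+ j)
    neg c j a y refl = go c j a y
      where
      go : ∀ c j a y → c ℤ.* a ℤ.* y ℤ.+ ℤ.- j ℤ.* (ℤ.- a) ≡ a ℤ.* (c ℤ.* y ℤ.+ j)
      go = solve-∀

    sgn : ∀ a {z} → + suc a ℤ.* z ℤ.< 0ℤ → z ℤ.< 0ℤ
    sgn a {z} lt = ℤ.*-cancelˡ-<-nonNeg (+ suc a) (subst (+ suc a ℤ.* z ℤ.<_) (sym (ℤ.*-zeroʳ (+ suc a))) lt)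

    nonpos : ∀ a {z} → z ℤ.≤ 0ℤ → + suc a ℤ.* z ℤ.≤ 0ℤ
    nonpos a {z} le = subst (+ suc a ℤ.* z ℤ.≤_) (ℤ.*-zeroʳ (+ suc a)) (ℤ.*-monoˡ-≤-nonNeg (+ suc a) le)

  slope-zero : ∀ j i y → slope Q j 0ℤ y ≡ slope Q i 0ℤ y
  slope-zero j i y = cong (λ z → + Q ℤ.* y ℤ.+ z) (trans (ℤ.*-zeroʳ (ℤ.- (+ j))) (sym (ℤ.*-zeroʳ (ℤ.- (+ i)))))

  -- Divisibility matters only for `x > 0`: the sign is then that of the integer `c·y − (j + 1)`,
  -- and negativity gives `c·y ≤ j`. For `x ≤ 0` passing to `j` does not raise the value. In
  -- `slope-suc` the signs of `x` are exchanged.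
  slope-pred : ∀ j {x y} → ∣ x ∣ ℕ.≤ X → slope Q (suc j) x y ℤ.< 0ℤ → slope Q j x y ℤ.≤ 0ℤ
  slope-pred j {+ zero} {y} _ lt = ℤ.<⇒≤ (subst (ℤ._< 0ℤ) (slope-zero (suc j) j y) lt)
  slope-pred j {+ suc a} {y} le lt with ∣Q a le
  ... | c , eq = subst (ℤ._≤ 0ℤ) (sym (pos (+ c) (+ j) (+ suc a) y Qeq)) (nonpos a {+ c ℤ.* y ℤ.- + j} bound)
    where
    Qeq : + Q ≡ + c ℤ.* + suc a
    Qeq = trans (cong +_ eq) (ℤ.pos-* c (suc a))
    go : ∀ u j → 0ℤ ℤ.- (u ℤ.- j) ≡ 0ℤ ℤ.- (1ℤ ℤ.+ (u ℤ.- (1ℤ ℤ.+ j)))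
    go = solve-∀
    bound : + c ℤ.* y ℤ.- + j ℤ.≤ 0ℤ
    bound = ≤-by (ℤ.i<j⇒suc[i]≤j (sgn a {+ c ℤ.* y ℤ.- + suc j} (subst (ℤ._< 0ℤ) (pos (+ c) (+ suc j) (+ suc a) y Qeq) lt))) (go (+ c ℤ.* y) (+ j))
  slope-pred j { -[1+ a ]} {y} le lt = ≤-by (ℤ.<⇒≤ lt ⊞ ℤ.+≤+ (z≤n {suc a})) (go (+ Q) y (+ j) (+ suc a))
    where
    go : ∀ q y j a → 0ℤ ℤ.- (q ℤ.* y ℤ.+ ℤ.- j ℤ.* (ℤ.- a)) ≡ 0ℤ ℤ.+ a ℤ.- (q ℤ.* y ℤ.+ ℤ.- (1ℤ ℤ.+ j) ℤ.* (ℤ.- a) ℤ.+ 0ℤ)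
    go = solve-∀

  slope-suc : ∀ j {x y} → ∣ x ∣ ℕ.≤ X → slope Q j x y ℤ.< 0ℤ → slope Q (suc j) x y ℤ.≤ 0ℤ
  slope-suc j {+ a} {y} _ lt = ≤-by (ℤ.<⇒≤ lt ⊞ ℤ.+≤+ (z≤n {a})) (go (+ Q) y (+ j) (+ a))
    where
    go : ∀ q y j a → 0ℤ ℤ.- (q ℤ.* y ℤ.+ ℤ.- (1ℤ ℤ.+ j) ℤ.* a) ≡ 0ℤ ℤ.+ a ℤ.- (q ℤ.* y ℤ.+ ℤ.- j ℤ.* a ℤ.+ 0ℤ)
    go = solve-∀
  slope-suc j { -[1+ a ]} {y} le lt with ∣Q a le
  ... | c , eq = subst (ℤ._≤ 0ℤ) (sym (neg (+ c) (+ suc j) (+ suc a) y Qeq)) (nonpos a {+ c ℤ.* y ℤ.+ + suc j} bound)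
    where
    Qeq : + Q ≡ + c ℤ.* + suc a
    Qeq = trans (cong +_ eq) (ℤ.pos-* c (suc a))
    go : ∀ u j → 0ℤ ℤ.- (u ℤ.+ (1ℤ ℤ.+ j)) ≡ 0ℤ ℤ.- (1ℤ ℤ.+ (u ℤ.+ j))
    go = solve-∀
    bound : + c ℤ.* y ℤ.+ + suc j ℤ.≤ 0ℤ
    bound = ≤-by (ℤ.i<j⇒suc[i]≤j (sgn a {+ c ℤ.* y ℤ.+ + j} (subst (ℤ._< 0ℤ) (neg (+ c) (+ j) (+ suc a) y Qeq) lt))) (go (+ c ℤ.* y) (+ j))

-- Determinacy of the first-cycle game.

all-or-some : ∀ {n} {P Q : Fin n → Set} → (∀ i → P i ⊎ Q i) → (∀ i → P i) ⊎ Σ (Fin n) Q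
all-or-some {zero}  f = inj₁ λ ()
all-or-some {suc n} f with f zero | all-or-some (λ i → f (suc i))
... | inj₂ q | _              = inj₂ (zero , q)
... | inj₁ _ | inj₂ (i , q)   = inj₂ (suc i , q)
... | inj₁ p | inj₁ ps        = inj₁ λ { zero → p ; (suc i) → ps i }

-- Counts the pairs not yet visited, which bounds the remaining length of a play.
nothings : ∀ {X : Set} {n} → Vec (Maybe X) n → ℕ
nothings []             = 0
nothings (just _  ∷ xs) = nothings xs
nothings (nothing ∷ xs) = suc (nothings xs)

nothings-replicate : ∀ {X : Set} n → nothings (replicate {A = Maybe X} n nothing) ≡ n
nothings-replicate zero    = refl
nothings-replicate (suc n) = cong suc (nothings-replicate n)

nothings-update : ∀ {X : Set} {n} (xs : Vec (Maybe X) n) i {x} → Vec.lookup xs i ≡ nothing →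
                  suc (nothings (xs [ i ]≔ just x)) ≡ nothings xs
nothings-update (nothing ∷ xs) zero    eq = refl
nothings-update (just _  ∷ xs) (suc i) eq = nothings-update xs i eq
nothings-update (nothing ∷ xs) (suc i) eq = cong suc (nothings-update xs i eq)

-- The best long-run response to a Spoiler move with a given target: there is none, it can
-- reach arbitrarily large counters, or its optimal effect on the counter is fixed.
data Option : Set where
  none jump : Option
  norm      : ℤ → Option

-- The first-cycle game for the weight w: the players move until a pair of control states
-- is repeated, and Duplicator wins if the cycle has w ≥ 0.  He also wins by entering the
-- set U or by an unbounded response into a pair where some counter value is winning.
-- In a tree for (v , r , a , b), (a , b) is the effect of the play so far on the two
-- counters, and v holds its value at the earlier visit of each pair.
module FirstCycle (G : Game) (fin : Fin (Game.N G) → Bool)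
                  (opt : ∀ r → Fin (Game.moves G r) → Fin (Game.N G) → Option)
                  (B : ℕ) (opt-bound : ∀ r μ r′ {β} → opt r μ r′ ≡ norm β → ∣ β ∣ ℕ.≤ B)
                  (w : ℤ → ℤ → ℤ) (U : Fin (Game.N G) → Bool) where
  open Game G

  Visited : Set
  Visited = Vec (Maybe (ℤ × ℤ)) N

  -- A play without repetition has at most `N` moves, each changing the counters by at most 1 and
  -- `B`.
  Bounded : ℤ → ℤ → Set
  Bounded a b = ∣ a ∣ ℕ.≤ N × ∣ b ∣ ℕ.≤ N ℕ.* B

  mutual
    data DTree (v : Visited) (r : Fin N) (a b : ℤ) : Set where
      node : Bounded a b →
             (∀ μ → Σ (Fin N) λ r′ → DReply (v [ r ]≔ just (a , b)) r μ r′ a b) → DTree v r a b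

    data DReply (v : Visited) (r : Fin N) (μ : Fin (moves r)) (r′ : Fin N) (a b : ℤ) : Set where
      jumps : fin r′ ≡ true → opt r μ r′ ≡ jump → DReply v r μ r′ a b
      sinks : ∀ {β} → opt r μ r′ ≡ norm β → U r′ ≡ true → DReply v r μ r′ a b
      cycle : ∀ {β a₀ b₀} → opt r μ r′ ≡ norm β → Vec.lookup v r′ ≡ just (a₀ , b₀) →
              0ℤ ℤ.≤ w (a ℤ.+ effect (eff r μ) ℤ.- a₀) (b ℤ.+ β ℤ.- b₀) → DReply v r μ r′ a b
      moves-to : ∀ {β} → opt r μ r′ ≡ norm β → DTree v r′ (a ℤ.+ effect (eff r μ)) (b ℤ.+ β) → DReply v r μ r′ a b

  mutual
    data STree (v : Visited) (r : Fin N) (a b : ℤ) : Set where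
      node : U r ≡ false → Bounded a b → (μ : Fin (moves r)) →
             (∀ r′ → SReply (v [ r ]≔ just (a , b)) r μ r′ a b) → STree v r a b

    data SReply (v : Visited) (r : Fin N) (μ : Fin (moves r)) (r′ : Fin N) (a b : ℤ) : Set where
      blocked  : opt r μ r′ ≡ none → SReply v r μ r′ a b
      infinite : fin r′ ≡ false → SReply v r μ r′ a b
      -- The size bounds are recorded because comparing adjacent slopes needs `x` to divide `Q`, and
      -- `steepest` needs a bound on `y`.
      cycle    : ∀ {β a₀ b₀} (let x = a ℤ.+ effect (eff r μ) ℤ.- a₀) (let y = b ℤ.+ β ℤ.- b₀) →
                 opt r μ r′ ≡ norm β → Vec.lookup v r′ ≡ just (a₀ , b₀) →
                 ∣ x ∣ ℕ.≤ N ℕ.+ N → ∣ y ∣ ℕ.≤ N ℕ.* B ℕ.+ N ℕ.* B → w x y ℤ.< 0ℤ → SReply v r μ r′ a b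
      moves-to : ∀ {β} → opt r μ r′ ≡ norm β → STree v r′ (a ℤ.+ effect (eff r μ)) (b ℤ.+ β) → SReply v r μ r′ a b

  -- Keeps the subtree of every visited pair. When a cycle closes, `pop` resumes the play at the
  -- earlier visit, which turns a first-cycle strategy into one for infinite plays.
  data Stack (Tree : Visited → Fin N → ℤ → ℤ → Set) : Visited → Set where
    []   : Stack Tree (replicate N nothing)
    push : ∀ {v r a b} → Stack Tree v → Tree v r a b → Stack Tree (v [ r ]≔ just (a , b))

  pop : ∀ {Tree v} → Stack Tree v → ∀ {r a b} → Vec.lookup v r ≡ just (a , b) →
        Σ Visited λ v₀ → Stack Tree v₀ × Tree v₀ r a b
  pop [] {r} eq with () ← trans (sym (lookup-replicate r nothing)) eq
  pop (push {v} {r₀} st t) {r} eq with r Fin.≟ r₀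
  ... | no r≢  = pop st (trans (sym (lookup∘update′ r≢ v _)) eq)
  ... | yes refl with refl ← trans (sym (lookup∘update r v _)) eq = v , st , t

  -- Backward induction on `f`, which bounds the number of unvisited pairs and is at the same time
  -- the number of moves left in the budget for `a` and `b`.
  determined : ∀ f v r a b → Vec.lookup v r ≡ nothing → nothings v ℕ.≤ f →
               ∣ a ∣ ℕ.+ f ℕ.≤ N → ∣ b ∣ ℕ.+ f ℕ.* B ℕ.≤ N ℕ.* B →
               (∀ i {a₀ b₀} → Vec.lookup v i ≡ just (a₀ , b₀) → Bounded a₀ b₀) →
               U r ≡ false → DTree v r a b ⊎ STree v r a b
  determined zero v r a b new le = ⊥-elim (ℕ.<⇒≱ (subst (0 ℕ.<_) (nothings-update v r {0ℤ , 0ℤ} new) (s≤s z≤n)) le)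
  determined (suc f) v r a b new le ha hb hv ur =
    [ (λ d → inj₁ (node bd d)) , (λ (μ , s) → inj₂ (node ur bd μ s)) ]′
      (all-or-some λ μ → swap (all-or-some λ r′ → reply μ r′))
    where
    bd : Bounded a b
    bd = ℕ.≤-trans (ℕ.m≤m+n _ _) ha , ℕ.≤-trans (ℕ.m≤m+n _ _) hb

    v′ : Visited
    v′ = v [ r ]≔ just (a , b)

    le′ : nothings v′ ℕ.≤ f
    le′ = ℕ.≤-pred (subst (ℕ._≤ suc f) (sym (nothings-update v r new)) le)

    hv′ : ∀ i {a₀ b₀} → Vec.lookup v′ i ≡ just (a₀ , b₀) → Bounded a₀ b₀
    hv′ i eq with i Fin.≟ r
    ... | no i≢  = hv i (trans (sym (lookup∘update′ i≢ v _)) eq)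
    ... | yes refl with refl ← trans (sym (lookup∘update r v _)) eq = bd

    add : ∀ x y {k z} → ∣ y ∣ ℕ.≤ k → ∣ x ∣ ℕ.+ (k ℕ.+ z) ℕ.≤ N ℕ.* B → ∣ x ℤ.+ y ∣ ℕ.+ z ℕ.≤ N ℕ.* B
    add x y {k} {z} hy h = ℕ.≤-trans (ℕ.+-monoˡ-≤ z (ℕ.≤-trans (ℤ.∣i+j∣≤∣i∣+∣j∣ x y) (ℕ.+-monoʳ-≤ ∣ x ∣ hy)))
                            (ℕ.≤-trans (ℕ.≤-reflexive (ℕ.+-assoc ∣ x ∣ k z)) h)

    sub : ∀ x y {k} → ∣ x ∣ ℕ.≤ k → ∣ y ∣ ℕ.≤ k → ∣ x ℤ.- y ∣ ℕ.≤ k ℕ.+ k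
    sub x y hx hy = ℕ.≤-trans (ℤ.∣i-j∣≤∣i∣+∣j∣ x y) (ℕ.+-mono-≤ hx hy)

    reply : ∀ μ r′ → SReply v′ r μ r′ a b ⊎ DReply v′ r μ r′ a b
    reply μ r′ with fin r′ in fe
    ... | false = inj₁ (infinite fe)
    ... | true with opt r μ r′ in oe
    ... | none = inj₁ (blocked oe)
    ... | jump = inj₂ (jumps fe oe)
    ... | norm β with U r′ in ue
    ... | true  = inj₂ (sinks oe ue)
    ... | false = visit (Vec.lookup v′ r′) refl
      where
      a′ b′ : ℤ
      a′ = a ℤ.+ effect (eff r μ)
      b′ = b ℤ.+ β

      ha′ : ∣ a′ ∣ ℕ.+ f ℕ.≤ N
      ha′ = ℕ.≤-trans (ℕ.+-monoˡ-≤ f (ℕ.≤-trans (ℤ.∣i+j∣≤∣i∣+∣j∣ a (effect (eff r μ))) (ℕ.+-monoʳ-≤ ∣ a ∣ (effect-bound (eff r μ)))))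
              (ℕ.≤-trans (ℕ.≤-reflexive (ℕ.+-assoc ∣ a ∣ 1 f)) ha)

      hb′ : ∣ b′ ∣ ℕ.+ f ℕ.* B ℕ.≤ N ℕ.* B
      hb′ = add b β (opt-bound r μ r′ oe) hb

      visit : ∀ x → Vec.lookup v′ r′ ≡ x → SReply v′ r μ r′ a b ⊎ DReply v′ r μ r′ a b
      visit nothing eq = [ (λ t → inj₂ (moves-to oe t)) , (λ t → inj₁ (moves-to oe t)) ]′
                           (determined f v′ r′ a′ b′ eq le′ ha′ hb′ hv′ ue)
      visit (just (a₀ , b₀)) eq with w (a′ ℤ.- a₀) (b′ ℤ.- b₀) ℤ.<? 0ℤ
      ... | no ≮  = inj₂ (cycle oe eq (ℤ.≮⇒≥ ≮))
      ... | yes lt = inj₁ (cycle oe eq (sub a′ a₀ (ℕ.≤-trans (ℕ.m≤m+n _ _) ha′) (proj₁ (hv′ r′ eq)))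
                                       (sub b′ b₀ (ℕ.≤-trans (ℕ.m≤m+n _ _) hb′) (proj₂ (hv′ r′ eq))) lt)

  start : ∀ r → U r ≡ false → DTree (replicate N nothing) r 0ℤ 0ℤ ⊎ STree (replicate N nothing) r 0ℤ 0ℤ
  start r = determined N (replicate N nothing) r 0ℤ 0ℤ (lookup-replicate r nothing)
    (ℕ.≤-reflexive (nothings-replicate N)) ℕ.≤-refl ℕ.≤-refl
    λ i eq → ⊥-elim (case (trans (sym (lookup-replicate i nothing)) eq))
    where
    case : ∀ {x : ℤ × ℤ} → nothing ≡ just x → ⊥
    case ()

-- Winning regions and play along a line.

record Arena (G : Game) (A : Set₁) : Set₂ where
  open Game G
  open Classical A
  open Approximants G A using (Rel₁; _⊆_; F; Closed)
  field
    W          : Rel₁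
    W-closed   : Closed W
    W-sim      : W ⊆ F W
    W-greatest : (R : Rel₁) → R ⊆ F (λ r m n → R r m n ⊎ W r m n) → R ⊆ W
    fin        : Fin N → Bool
    M          : ℕ
    fin-true   : ∀ {r} → fin r ≡ true → ∀ m → T (Σ ℕ (W r m))
    fin-false  : ∀ {r m n} → fin r ≡ false → M ℕ.≤ m → W r m n → A
    opt        : ∀ r → Fin (moves r) → Fin N → Option
    g B        : ℕ
    opt-bound  : ∀ r μ r′ {β} → opt r μ r′ ≡ norm β → ∣ β ∣ ℕ.≤ B
    opt-none   : ∀ {r μ r′ n n′} → opt r μ r′ ≡ none → Rsp r μ r′ n n′ → A
    opt-jump   : ∀ {r μ r′ n} → opt r μ r′ ≡ jump → g ℕ.≤ n → Unbounded r μ r′ n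
    opt-norm   : ∀ {r μ r′ n β} → opt r μ r′ ≡ norm β → g ℕ.≤ n →
                 Σ ℕ λ n′ → Rsp r μ r′ n n′ × + n′ ≡ + n ℤ.+ β
    opt-best   : ∀ {r μ r′ n n′ β} → opt r μ r′ ≡ norm β → Rsp r μ r′ n n′ → + n′ ℤ.≤ + n ℤ.+ β ⊎ A

-- Since `Q·n` is nonnegative, a very negative value can only come from a large `m`.
slope-large : ∀ Q j {m n X} → slope Q j (+ m) (+ n) ℤ.< ℤ.- (+ (j ℕ.* X)) → X ℕ.< m
slope-large Q j {m} {n} {X} lt = ℕ.*-cancelˡ-< j X m (ℤ.drop‿+<+ (ℤ.<-≤-trans flip bound))
  where
  flip : + (j ℕ.* X) ℤ.< ℤ.- slope Q j (+ m) (+ n)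
  flip = subst (ℤ._< ℤ.- slope Q j (+ m) (+ n)) (ℤ.neg-involutive _) (ℤ.neg-mono-< lt)
  go : ∀ qn j m → j ℤ.* m ℤ.- (ℤ.- (qn ℤ.+ ℤ.- j ℤ.* m)) ≡ qn ℤ.- 0ℤ
  go = solve-∀
  bound : ℤ.- slope Q j (+ m) (+ n) ℤ.≤ + (j ℕ.* m)
  bound = subst (ℤ.- slope Q j (+ m) (+ n) ℤ.≤_) (sym (ℤ.pos-* j m))
    (≤-by (ℤ.+≤+ (z≤n {Q ℕ.* n})) (trans (go (+ Q ℤ.* + n) (+ j) (+ m)) (cong (ℤ._- 0ℤ) (sym (ℤ.pos-* Q n)))))

slope-n-large : ∀ Q j .{{_ : ℕ.NonZero Q}} {m n g} → + (Q ℕ.* g) ℤ.≤ slope Q j (+ m) (+ n) → g ℕ.≤ n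
slope-n-large Q j {m} {n} {g} le = ℕ.*-cancelˡ-≤ Q (ℤ.drop‿+≤+ (ℤ.≤-trans le bound))
  where
  go : ∀ qn j m → qn ℤ.- (qn ℤ.+ ℤ.- j ℤ.* m) ≡ j ℤ.* m ℤ.- 0ℤ
  go = solve-∀
  bound : slope Q j (+ m) (+ n) ℤ.≤ + (Q ℕ.* n)
  bound = subst (slope Q j (+ m) (+ n) ℤ.≤_) (sym (ℤ.pos-* Q n))
    (≤-by (ℤ.+≤+ (z≤n {j ℕ.* m})) (trans (go (+ Q ℤ.* + n) (+ j) (+ m)) (cong (ℤ._- 0ℤ) (sym (ℤ.pos-* j m)))))

module Belts (G : Game) (A : Set₁) (E : Arena G A) where
  open Game G
  open Classical A
  open Approximants G A using (Rel₁; _⊆_; F; Closed)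
  open Arena E
  open Adjacent (N ℕ.+ N)

  instance
    Q≢0 : ℕ.NonZero Q
    Q≢0 = (N ℕ.+ N) ℕ.!≢0

  ws : ℕ → ℤ → ℤ → ℤ
  ws = slope Q

  -- For pairs outside `U` the frontier eventually lies above every line of slope `j/Q`.
  SClaim : ℕ → (Fin N → Bool) → Set₁
  SClaim j U = ∀ e → Σ ℕ λ M′ → ∀ {r m n} → U r ≡ false → M′ ℕ.≤ m → ws j (+ m) (+ n) ℤ.≤ + e → W r m n → A

  module Stage (j : ℕ) (U : Fin N → Bool) where

    w : ℤ → ℤ → ℤ
    w = ws j

    open FirstCycle G fin opt B opt-bound w U public

    bd : ℕ → ℤ → ℕ
    bd c e = c ℕ.* (N ℕ.* B) ℕ.+ ∣ e ∣ ℕ.* N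

    Bd : ℕ
    Bd = bd Q (ℤ.- (+ j))

    lin≤bd : ∀ c e {a b} → Bounded a b → lin c e a b ℤ.≤ + bd c e
    lin≤bd c e {a} {b} (ha , hb) = ℤ.≤-trans (i≤∣i∣ (lin c e a b)) (ℤ.+≤+ (lin-bound c e ha hb))

    -Bd≤w : ∀ {a b} → Bounded a b → ℤ.- (+ Bd) ℤ.≤ w a b
    -Bd≤w {a} {b} (ha , hb) = ℤ.≤-trans (ℤ.neg-mono-≤ (ℤ.+≤+ (lin-bound Q (ℤ.- (+ j)) ha hb))) (-∣i∣≤i (w a b))

    module Defence (C₀ : ℕ) (sink : ∀ {r m n} → U r ≡ true → + C₀ ℤ.≤ w (+ m) (+ n) → W r m n) where

      Bs C : ℕ
      Bs = Q ℕ.* B ℕ.+ ∣ ℤ.- (+ j) ∣ ℕ.* 1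
      -- `Bd` absorbs the unfinished part of the play, `Q·g` keeps Duplicator's counter at least `g`
      -- so that optimal responses exist, `Bs` pays for the move into a sink, and `C₀` is what the
      -- sink requires.
      C = C₀ ℕ.+ Bs ℕ.+ Q ℕ.* g ℕ.+ Bd

      -- An invariant up to forgotten cycles: closing one with `w ≥ 0` replaces `(a , b)` by the
      -- earlier `(a₀ , b₀)` and preserves the inequality.
      data Guarded : Rel₁ where
        guarded : ∀ {v r a b m n} → Stack DTree v → DTree v r a b →
                  + C ℤ.+ w a b ℤ.≤ w (+ m) (+ n) → Guarded r m n

      GW : Rel₁
      GW r m n = Guarded r m n ⊎ W r m n

      guarded-post : Guarded ⊆ F GW
      guarded-post {m = m} {n = n} (guarded {v} {r} {a} {b} st t@(node bdd ds) inv) μ {m′} ap =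
        reply (proj₁ (ds μ)) (proj₂ (ds μ))
        where
        big : + (C₀ ℕ.+ Bs ℕ.+ Q ℕ.* g) ℤ.≤ w (+ m) (+ n)
        big = ≤-by (inv ⊞ -Bd≤w bdd) (go (+ (C₀ ℕ.+ Bs ℕ.+ Q ℕ.* g)) (+ Bd) (w a b) (w (+ m) (+ n)))
          where
          go : ∀ c d x y → y ℤ.- c ≡ y ℤ.+ x ℤ.- (c ℤ.+ d ℤ.+ x ℤ.+ ℤ.- d)
          go = solve-∀

        g≤n : g ℕ.≤ n
        g≤n = slope-n-large Q j (ℤ.≤-trans (ℤ.+≤+ (ℕ.m≤n+m (Q ℕ.* g) (C₀ ℕ.+ Bs))) big)

        dx : ℤ
        dx = effect (eff r μ)

        w-step : ∀ {n′ β} → + n′ ≡ + n ℤ.+ β → w (+ m′) (+ n′) ≡ w (+ m) (+ n) ℤ.+ w dx β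
        w-step {β = β} eq = trans (cong₂ w (apply-effect ap) eq) (lin-+ Q (ℤ.- (+ j)) (+ m) (+ n) dx β)

        v′ : Visited
        v′ = v [ r ]≔ just (a , b)

        reply : ∀ r′ → DReply v′ r μ r′ a b → T (Σ (Fin N) λ r′ → Σ ℕ λ n′ → Rsp r μ r′ n n′ × GW r′ m′ n′)
        reply r′ (jumps fr oe) = fin-true fr m′ >>= λ (k , wk) →
          let (n′ , k≤n′ , ρ) = opt-jump oe g≤n k in
          return (r′ , n′ , ρ , inj₂ (W-closed ℕ.≤-refl k≤n′ wk))
        reply r′ (sinks {β} oe ur) with opt-norm oe g≤n
        ... | n′ , ρ , eq = return (r′ , n′ , ρ , inj₂ (sink ur (subst (+ C₀ ℤ.≤_) (sym (w-step eq)) sum)))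
          where
          go : ∀ c s q u v → u ℤ.+ v ℤ.- c ≡ u ℤ.+ v ℤ.+ q ℤ.- (c ℤ.+ s ℤ.+ q ℤ.+ ℤ.- s ℤ.+ 0ℤ)
          go = solve-∀
          step≥ : ℤ.- (+ Bs) ℤ.≤ w dx β
          step≥ = ℤ.≤-trans (ℤ.neg-mono-≤ (ℤ.+≤+ (lin-bound Q (ℤ.- (+ j)) (effect-bound (eff r μ)) (opt-bound r μ r′ oe)))) (-∣i∣≤i (w dx β))
          sum : + C₀ ℤ.≤ w (+ m) (+ n) ℤ.+ w dx β
          sum = ≤-by (big ⊞ step≥ ⊞ ℤ.+≤+ (z≤n {Q ℕ.* g})) (go (+ C₀) (+ Bs) (+ (Q ℕ.* g)) (w (+ m) (+ n)) (w dx β))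
        reply r′ (moves-to {β} oe t′) with opt-norm oe g≤n
        ... | n′ , ρ , eq = return (r′ , n′ , ρ , inj₁ (guarded (push st t) t′
              (subst₂ ℤ._≤_ (cong (λ z → + C ℤ.+ z) (sym (lin-+ Q (ℤ.- (+ j)) a b dx β))) (sym (w-step eq))
                (≤-by inv (go (+ C) (w a b) (w (+ m) (+ n)) (w dx β))))))
          where
          go : ∀ c x y s → y ℤ.+ s ℤ.- (c ℤ.+ (x ℤ.+ s)) ≡ y ℤ.- (c ℤ.+ x)
          go = solve-∀
        reply r′ (cycle {β} {a₀} {b₀} oe eq₀ nn) with opt-norm oe g≤n | pop (push st t) eq₀
        ... | n′ , ρ , eq | v₀ , st₀ , t₀ = return (r′ , n′ , ρ , inj₁ (guarded st₀ t₀
              (subst (+ C ℤ.+ w a₀ b₀ ℤ.≤_) (sym (w-step eq)) (≤-by (inv ⊞ nn′) (go (+ C) (w a b) (w (+ m) (+ n)) (w dx β) (w a₀ b₀))))))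
          where
          nn′ : 0ℤ ℤ.≤ w a b ℤ.+ w dx β ℤ.- w a₀ b₀
          nn′ = subst (0ℤ ℤ.≤_) (trans (lin-- Q (ℤ.- (+ j)) (a ℤ.+ dx) (b ℤ.+ β) a₀ b₀)
                  (cong (ℤ._- w a₀ b₀) (lin-+ Q (ℤ.- (+ j)) a b dx β))) nn
          go : ∀ c x y s z → y ℤ.+ s ℤ.- (c ℤ.+ z) ≡ y ℤ.+ (x ℤ.+ s ℤ.- z) ℤ.- (c ℤ.+ x ℤ.+ 0ℤ)
          go = solve-∀

      defence : ∀ {r m n} → DTree (replicate N nothing) r 0ℤ 0ℤ → + C ℤ.≤ w (+ m) (+ n) → W r m n
      defence {m = m} {n} t le = W-greatest Guarded guarded-post (guarded [] t
        (subst (ℤ._≤ w (+ m) (+ n)) (sym (trans (cong (λ z → + C ℤ.+ z) (lin-0 Q (ℤ.- (+ j)))) (ℤ.+-identityʳ (+ C)))) le))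

    -- Spoiler follows a first-cycle strategy and forgets each completed cycle; k counts these,
    -- and each linear functional of the counters drifts by at most δ per cycle.
    module Play {Ix : Set} (c : Ix → ℕ) (e δ : Ix → ℤ)
                (drop : ∀ i {x y} → ∣ x ∣ ℕ.≤ N ℕ.+ N → ∣ y ∣ ℕ.≤ N ℕ.* B ℕ.+ N ℕ.* B → w x y ℤ.< 0ℤ →
                        lin (c i) (e i) x y ℤ.≤ δ i)
                (m₀ n₀ Kmax : ℕ) where

      record Inv (k : ℕ) (a b : ℤ) (m n : ℕ) : Set where
        constructor inv
        field at : ∀ i → lin (c i) (e i) (+ m) (+ n) ℤ.≤
                         lin (c i) (e i) (+ m₀) (+ n₀) ℤ.+ + k ℤ.* δ i ℤ.+ lin (c i) (e i) a b

      inv-start : Inv 0 0ℤ 0ℤ m₀ n₀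
      inv-start = inv λ i → let u = lin (c i) (e i) (+ m₀) (+ n₀) in
        ≤-by (ℤ.≤-refl {0ℤ}) (trans (cong (λ z → u ℤ.+ 0ℤ ℤ.* δ i ℤ.+ z ℤ.- u) (lin-0 (c i) (e i))) (go u (δ i)))
        where
        go : ∀ u d → u ℤ.+ 0ℤ ℤ.* d ℤ.+ 0ℤ ℤ.- u ≡ 0ℤ ℤ.- 0ℤ
        go = solve-∀

      inv-step : ∀ {k a b m n m′ n′ β} d → Apply d m m′ → + n′ ℤ.≤ + n ℤ.+ β → Inv k a b m n →
                 Inv k (a ℤ.+ effect d) (b ℤ.+ β) m′ n′
      inv-step {k} {a} {b} {m} {n} {m′} {n′} {β} d ap le (inv h) = inv λ i → let u = lin (c i) (e i) (+ m₀) (+ n₀) in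
        ≤-by (h i ⊞ ℤ.*-monoˡ-≤-nonNeg (+ c i) le)
          (trans (cong (λ z → u ℤ.+ + k ℤ.* δ i ℤ.+ lin (c i) (e i) (a ℤ.+ effect d) (b ℤ.+ β) ℤ.- (+ c i ℤ.* + n′ ℤ.+ e i ℤ.* z)) (apply-effect ap))
                 (go (+ c i) (e i) (u ℤ.+ + k ℤ.* δ i) a b (effect d) β (+ m) (+ n) (+ n′)))
        where
        go : ∀ c e u a b x y m n n′ →
             u ℤ.+ (c ℤ.* (b ℤ.+ y) ℤ.+ e ℤ.* (a ℤ.+ x)) ℤ.- (c ℤ.* n′ ℤ.+ e ℤ.* (m ℤ.+ x)) ≡
             u ℤ.+ (c ℤ.* b ℤ.+ e ℤ.* a) ℤ.+ c ℤ.* (n ℤ.+ y) ℤ.- (c ℤ.* n ℤ.+ e ℤ.* m ℤ.+ c ℤ.* n′)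
        go = solve-∀

      inv-cycle : ∀ {k a b m n} a₀ b₀ → (∀ i → lin (c i) (e i) (a ℤ.- a₀) (b ℤ.- b₀) ℤ.≤ δ i) →
                  Inv k a b m n → Inv (suc k) a₀ b₀ m n
      inv-cycle {k} {a} {b} {m} {n} a₀ b₀ neg (inv h) = inv λ i →
        ≤-by (h i ⊞ subst (ℤ._≤ δ i) (lin-- (c i) (e i) a b a₀ b₀) (neg i))
          (go (lin (c i) (e i) (+ m₀) (+ n₀)) (+ k) (δ i) (lin (c i) (e i) a b) (lin (c i) (e i) a₀ b₀) (lin (c i) (e i) (+ m) (+ n)))
        where
        go : ∀ u k d x x₀ z → u ℤ.+ (1ℤ ℤ.+ k) ℤ.* d ℤ.+ x₀ ℤ.- z ≡ u ℤ.+ k ℤ.* d ℤ.+ x ℤ.+ d ℤ.- (z ℤ.+ (x ℤ.- x₀))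
        go = solve-∀

      -- Above `M` Spoiler can make any move, and `fin-false` still applies after it.
      enabled : ∀ d {m} → suc M ℕ.≤ m → Σ ℕ λ m′ → Apply d m m′ × M ℕ.≤ m′
      enabled dec (s≤s le) = _ , app-dec , le
      enabled zer le       = _ , app-zer , ℕ.≤-trans (ℕ.n≤1+n M) le
      enabled inc le       = _ , app-inc , ℕ.m≤n⇒m≤1+n (ℕ.≤-trans (ℕ.n≤1+n M) le)

      module _ (safe : ∀ {k a b m n} → Bounded a b → Inv k a b m n → suc M ℕ.≤ m)
               (exit : ∀ {r a b m n} → U r ≡ false → Bounded a b → Inv Kmax a b m n → W r m n → A) where

        mutual
          -- Each move descends in the strategy tree and each closed cycle consumes one unit of
          -- `fuel`, so the play ends; after `Kmax` cycles `exit` takes over.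
          play : ∀ fuel {k v r a b m n} → k ℕ.+ fuel ≡ Kmax → Stack STree v → STree v r a b →
                 Inv k a b m n → W r m n → A
          play zero {k} {a = a} {b} {m} {n} eq st (node ur bdd _ _) iv wr =
            exit ur bdd (subst (λ z → Inv z a b m n) (trans (sym (ℕ.+-identityʳ k)) eq) iv) wr
          play (suc fuel) {r = r} eq st (node ur bdd μ rs) iv wr =
            let (m′ , ap , M≤m′) = enabled (eff r μ) (safe bdd iv) in
            W-sim wr μ ap λ (r′ , n′ , ρ , wr′) →
              answer (suc fuel) (s≤s z≤n) eq (push st (node ur bdd μ rs)) μ ap M≤m′ iv ρ wr′ (rs r′)

          answer : ∀ fuel {k v r a b m n m′ n′ r′} → 1 ℕ.≤ fuel → k ℕ.+ fuel ≡ Kmax → Stack STree v → ∀ μ →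
                   Apply (eff r μ) m m′ → M ℕ.≤ m′ → Inv k a b m n → Rsp r μ r′ n n′ → W r′ m′ n′ →
                   SReply v r μ r′ a b → A
          answer fuel pos eq st μ ap M≤ iv ρ wr (blocked oe)   = opt-none oe ρ
          answer fuel pos eq st μ ap M≤ iv ρ wr (infinite fe)  = fin-false fe M≤ wr
          answer fuel pos eq st μ ap M≤ iv ρ wr (moves-to oe t) with opt-best oe ρ
          ... | inj₂ x  = x
          ... | inj₁ le = play fuel eq st t (inv-step _ ap le iv) wr
          answer (suc fuel) {k} pos eq st μ ap M≤ iv ρ wr (cycle {a₀ = a₀} {b₀} oe eq₀ hx hy neg) with opt-best oe ρ | pop st eq₀
          ... | inj₂ x  | _ = x
          ... | inj₁ le | v₀ , st₀ , t₀ =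
                play fuel (trans (sym (ℕ.+-suc k fuel)) eq) st₀ t₀
                  (inv-cycle a₀ b₀ (λ i → drop i hx hy neg) (inv-step _ ap le iv)) wr

-- Spoiler's attacks below a line.

module Attacks (G : Game) (A : Set₁) (E : Arena G A) where
  open Game G
  open Classical A
  open Arena E
  open Adjacent (N ℕ.+ N)
  open Belts G A E

  Prev : ℕ → (Fin N → Bool) → Set₁
  Prev zero    U = Lift _ ⊤
  Prev (suc j) U = SClaim j U

  limit : ∀ j {U} → Prev j U → ℕ → ℕ
  limit zero    _    _ = 0
  limit (suc j) prev e = proj₁ (prev e)

  -- Per cycle, the value for slope `j` drops by at least one, the value for the next smaller slope
  -- does not rise, and the auxiliary functional drifts by at most `δ₃`.
  data Ix : Set where
    cur low aux : Ix

  module Attack (j : ℕ) (U : Fin N → Bool) (prev : Prev j U) where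
    open Stage j U

    -- Play the strategy for slope j/Q until Spoiler's counter is so large that the strategy
    -- for the next smaller slope wins; the third functional keeps the counter positive meanwhile.
    module With (c₃ : ℕ) (e₃ δ₃ : ℤ)
                (drop₃ : ∀ {x y} → ∣ x ∣ ℕ.≤ N ℕ.+ N → ∣ y ∣ ℕ.≤ N ℕ.* B ℕ.+ N ℕ.* B → w x y ℤ.< 0ℤ →
                         lin c₃ e₃ x y ℤ.≤ δ₃)
                (m₀ n₀ : ℕ) where

      c : Ix → ℕ
      c aux = c₃
      c _   = Q

      e Δ : Ix → ℤ
      e cur = ℤ.- (+ j)
      e low = ℤ.- (+ ℕ.pred j)
      e aux = e₃
      Δ cur = -1ℤ
      Δ low = 0ℤ
      Δ aux = δ₃

      drop : ∀ i {x y} → ∣ x ∣ ℕ.≤ N ℕ.+ N → ∣ y ∣ ℕ.≤ N ℕ.* B ℕ.+ N ℕ.* B → w x y ℤ.< 0ℤ →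
             lin (c i) (e i) x y ℤ.≤ Δ i
      drop cur hx hy lt = ℤ.i<j⇒i≤pred[j] lt
      drop low hx hy lt = low-drop j hx lt
        where
        low-drop : ∀ j {x y} → ∣ x ∣ ℕ.≤ N ℕ.+ N → ws j x y ℤ.< 0ℤ → ws (ℕ.pred j) x y ℤ.≤ 0ℤ
        low-drop zero    _  lt = ℤ.<⇒≤ lt
        low-drop (suc j) hx lt = slope-pred j hx lt
      drop aux hx hy lt = drop₃ hx hy lt

      w₀ w₁ : ℤ
      w₀ = w (+ m₀) (+ n₀)
      w₁ = ws (ℕ.pred j) (+ m₀) (+ n₀)

      e₁ L Kmax : ℕ
      e₁ = ∣ w₁ ∣ ℕ.+ bd Q (ℤ.- (+ ℕ.pred j))
      L = limit j prev e₁
      -- So many drops push the value for slope `j` below `−j·L`, whatever the start and the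
      -- unfinished part; `slope-large` then yields a counter above `L`, where the previous stage
      -- wins.
      Kmax = suc (∣ w₀ ∣ ℕ.+ Bd ℕ.+ j ℕ.* L)

      open Play c e Δ drop m₀ n₀ Kmax

      bounded-at : ∀ i {k a b m n} → Bounded a b → Inv k a b m n →
                   lin (c i) (e i) (+ m) (+ n) ℤ.≤ lin (c i) (e i) (+ m₀) (+ n₀) ℤ.+ + k ℤ.* Δ i ℤ.+ + bd (c i) (e i)
      bounded-at i {k} bdd (inv h) = ℤ.≤-trans (h i)
        (ℤ.+-monoʳ-≤ (lin (c i) (e i) (+ m₀) (+ n₀) ℤ.+ + k ℤ.* Δ i) (lin≤bd (c i) (e i) bdd))

      exit : ∀ {r a b m n} → U r ≡ false → Bounded a b → Inv Kmax a b m n → W r m n → A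
      exit {r} {m = m} {n = n} ur bdd iv wr = switch j prev ur small (low-bound iv) wr
        where
        go : ∀ w a b l z → ℤ.- (1ℤ ℤ.+ l) ℤ.- z ≡ w ℤ.+ (1ℤ ℤ.+ (a ℤ.+ b ℤ.+ l)) ℤ.* -1ℤ ℤ.+ b ℤ.+ a ℤ.- (z ℤ.+ w)
        go = solve-∀
        small : w (+ m) (+ n) ℤ.< ℤ.- (+ (j ℕ.* L))
        small = ℤ.≤-<-trans (≤-by (bounded-at cur bdd iv ⊞ i≤∣i∣ w₀)
                  (go w₀ (+ ∣ w₀ ∣) (+ Bd) (+ (j ℕ.* L)) (w (+ m) (+ n))))
                  (ℤ.neg-mono-< (ℤ.+<+ ℕ.≤-refl))
        low-bound : Inv Kmax _ _ m n → ws (ℕ.pred j) (+ m) (+ n) ℤ.≤ + e₁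
        low-bound iv = ≤-by (bounded-at low bdd iv ⊞ i≤∣i∣ w₁)
                    (go′ w₁ (+ Kmax) (+ ∣ w₁ ∣) (+ bd Q (ℤ.- (+ ℕ.pred j))) (ws (ℕ.pred j) (+ m) (+ n)))
          where
          go′ : ∀ w k a b z → a ℤ.+ b ℤ.- z ≡ w ℤ.+ k ℤ.* 0ℤ ℤ.+ b ℤ.+ a ℤ.- (z ℤ.+ w)
          go′ = solve-∀
        switch : ∀ i (p : Prev i U) → U r ≡ false →
                 ws i (+ m) (+ n) ℤ.< ℤ.- (+ (i ℕ.* limit i p e₁)) →
                 ws (ℕ.pred i) (+ m) (+ n) ℤ.≤ + e₁ → W r m n → A
        switch zero    p ur lt le wr = ⊥-elim (ℕ.<-irrefl refl (slope-large Q 0 {m} {n} {m} lt))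
        switch (suc i) p ur lt le wr = proj₂ (p e₁) ur (ℕ.<⇒≤ (slope-large Q (suc i) {m} {n} lt)) le wr

      attack : (∀ k {m n} → w (+ m) (+ n) ℤ.≤ w₀ ℤ.+ + k ℤ.* -1ℤ ℤ.+ + Bd →
                lin c₃ e₃ (+ m) (+ n) ℤ.≤ lin c₃ e₃ (+ m₀) (+ n₀) ℤ.+ + k ℤ.* δ₃ ℤ.+ + bd c₃ e₃ → suc M ℕ.≤ m) →
               ∀ {r} → STree (replicate N nothing) r 0ℤ 0ℤ → W r m₀ n₀ → A
      attack safe t = play (λ {k} bdd iv → safe k (bounded-at cur bdd iv) (bounded-at aux bdd iv)) exit
                        Kmax refl [] t inv-start

    Lost : Fin N → Set
    Lost r = fin r ≡ false ⊎ STree (replicate N nothing) r 0ℤ 0ℤ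

    -m : ∀ m n → lin 0 -1ℤ (+ m) (+ n) ≡ ℤ.- (+ m)
    -m m n = go (+ m) (+ n)
      where
      go : ∀ m n → 0ℤ ℤ.* n ℤ.+ -1ℤ ℤ.* m ≡ ℤ.- m
      go = solve-∀

    -- A cycle costs Spoiler at most `N + N`, so during the first `k₀` cycles the start beyond `M′`
    -- keeps his counter above `M`; afterwards the value is so low that `slope-large` does.
    below-line : ∀ e → Σ ℕ λ M′ → ∀ {r m n} → Lost r → M′ ℕ.≤ m → w (+ m) (+ n) ℤ.≤ + e → W r m n → A
    below-line e = M′ , λ
      { (inj₁ fe) M′≤m _ → fin-false fe (ℕ.≤-trans (ℕ.≤-trans (ℕ.n≤1+n M) (ℕ.m≤m+n (suc M) _)) M′≤m)
      ; {m = m₀} {n₀} (inj₂ t) M′≤m le → let open With 0 -1ℤ (+ (N ℕ.+ N)) drop₃ m₀ n₀ in attack (safe M′≤m le) t }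
      where
      k₀ M′ : ℕ
      k₀ = e ℕ.+ Bd ℕ.+ j ℕ.* suc M
      M′ = suc M ℕ.+ (k₀ ℕ.* (N ℕ.+ N) ℕ.+ bd 0 -1ℤ)

      drop₃ : ∀ {x y} → ∣ x ∣ ℕ.≤ N ℕ.+ N → ∣ y ∣ ℕ.≤ N ℕ.* B ℕ.+ N ℕ.* B → w x y ℤ.< 0ℤ → lin 0 -1ℤ x y ℤ.≤ + (N ℕ.+ N)
      drop₃ {x} {y} hx _ _ = ≤-by (-∣i∣≤i x ⊞ ℤ.+≤+ hx) (go x y (+ ∣ x ∣) (+ (N ℕ.+ N)))
        where
        go : ∀ x y a n → n ℤ.- (0ℤ ℤ.* y ℤ.+ -1ℤ ℤ.* x) ≡ x ℤ.+ n ℤ.- (ℤ.- a ℤ.+ a)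
        go = solve-∀

      safe : ∀ {m₀ n₀} → M′ ℕ.≤ m₀ → w (+ m₀) (+ n₀) ℤ.≤ + e → ∀ k {m n} →
             w (+ m) (+ n) ℤ.≤ w (+ m₀) (+ n₀) ℤ.+ + k ℤ.* -1ℤ ℤ.+ + Bd →
             lin 0 -1ℤ (+ m) (+ n) ℤ.≤ lin 0 -1ℤ (+ m₀) (+ n₀) ℤ.+ + k ℤ.* + (N ℕ.+ N) ℤ.+ + bd 0 -1ℤ → suc M ℕ.≤ m
      safe {m₀} {n₀} M′≤m₀ le k {m} {n} h₁ h₂ with k ℕ.≤? k₀
      ... | yes k≤k₀ = ℤ.drop‿+≤+ (≤-by
              (subst₂ (λ u v → u ℤ.≤ v ℤ.+ + k ℤ.* + (N ℕ.+ N) ℤ.+ + bd 0 -1ℤ) (-m m n) (-m m₀ n₀) h₂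
                ⊞ ℤ.*-monoʳ-≤-nonNeg (+ (N ℕ.+ N)) (ℤ.+≤+ k≤k₀) ⊞ ℤ.+≤+ M′≤m₀)
              (trans (go (+ m) (+ suc M) (+ m₀) (+ k) (+ (N ℕ.+ N)) (+ bd 0 -1ℤ) (+ k₀ ℤ.* + (N ℕ.+ N)))
                     (cong (λ z → ℤ.- (+ m₀) ℤ.+ + k ℤ.* + (N ℕ.+ N) ℤ.+ + bd 0 -1ℤ ℤ.+ + k₀ ℤ.* + (N ℕ.+ N) ℤ.+ + m₀ ℤ.-
                                    (ℤ.- (+ m) ℤ.+ + k ℤ.* + (N ℕ.+ N) ℤ.+ (+ suc M ℤ.+ (z ℤ.+ + bd 0 -1ℤ)))) (sym (ℤ.pos-* k₀ (N ℕ.+ N))))))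
        where
        go : ∀ m s m₀ k n b z → m ℤ.- s ≡ ℤ.- m₀ ℤ.+ k ℤ.* n ℤ.+ b ℤ.+ z ℤ.+ m₀ ℤ.- (ℤ.- m ℤ.+ k ℤ.* n ℤ.+ (s ℤ.+ (z ℤ.+ b)))
        go = solve-∀
      ... | no k≰k₀ = ℕ.<⇒≤ (slope-large Q j {m} {n} {suc M} (ℤ.≤-<-trans
              (≤-by (h₁ ⊞ le ⊞ ℤ.+≤+ (ℕ.≰⇒> k≰k₀)) (go (w (+ m) (+ n)) (w (+ m₀) (+ n₀)) (+ k) (+ Bd) (+ e) (+ (j ℕ.* suc M))))
              (ℤ.neg-mono-< (ℤ.+<+ (ℕ.n<1+n (j ℕ.* suc M))))))
        where
        go : ∀ w w₀ k b e l → ℤ.- (1ℤ ℤ.+ l) ℤ.- w ≡ w₀ ℤ.+ k ℤ.* -1ℤ ℤ.+ b ℤ.+ e ℤ.+ k ℤ.- (w ℤ.+ w₀ ℤ.+ (1ℤ ℤ.+ (e ℤ.+ b ℤ.+ l)))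
        go = solve-∀

    -- By `slope-suc` a cycle that is negative for `j` does not raise the value for `j + 1`. A start
    -- far below the steeper line therefore stays there, and `slope-large` keeps `m` above `M`
    -- whatever the starting column.
    far-below-next : Σ ℕ λ C → ∀ {r m n} → STree (replicate N nothing) r 0ℤ 0ℤ →
                     ws (suc j) (+ m) (+ n) ℤ.≤ ℤ.- (+ C) → W r m n → A
    far-below-next = C , λ {_} {m₀} {n₀} t le →
      let open With Q (ℤ.- (+ suc j)) 0ℤ (λ hx _ lt → slope-suc j hx lt) m₀ n₀ in attack (λ k {m} {n} _ h → safe m₀ n₀ le k m n h) t
      where
      b C : ℕ
      b = bd Q (ℤ.- (+ suc j))
      C = suc (b ℕ.+ suc j ℕ.* suc M)
      safe : ∀ m₀ n₀ → ws (suc j) (+ m₀) (+ n₀) ℤ.≤ ℤ.- (+ C) → ∀ k m n →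
             ws (suc j) (+ m) (+ n) ℤ.≤ ws (suc j) (+ m₀) (+ n₀) ℤ.+ + k ℤ.* 0ℤ ℤ.+ + b → suc M ℕ.≤ m
      safe m₀ n₀ le k m n h = ℕ.<⇒≤ (slope-large Q (suc j) {m} {n} {suc M} (ℤ.≤-<-trans
        (≤-by (h ⊞ le) (go (ws (suc j) (+ m) (+ n)) (ws (suc j) (+ m₀) (+ n₀)) (+ k) (+ b) (+ (suc j ℕ.* suc M))))
        (ℤ.neg-mono-< (ℤ.+<+ (ℕ.n<1+n (suc j ℕ.* suc M))))))
        where
        go : ∀ w w₀ k b l → ℤ.- (1ℤ ℤ.+ l) ℤ.- w ≡ w₀ ℤ.+ k ℤ.* 0ℤ ℤ.+ b ℤ.+ ℤ.- (1ℤ ℤ.+ (b ℤ.+ l)) ℤ.- (w ℤ.+ w₀)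
        go = solve-∀

    -- For `j/Q` this large, a negative cycle has `x ≥ 0`. Spoiler's counter then never falls over a
    -- cycle, so from the column `m₀` he beats every `n₀`, which contradicts `fin r`.
    steepest : Q ℕ.* (N ℕ.* B ℕ.+ N ℕ.* B) ℕ.≤ j → ∀ {r} → fin r ≡ true → STree (replicate N nothing) r 0ℤ 0ℤ → A
    steepest hj {r} fr t = fin-true fr m₀ λ (n₀ , wr) →
      let open With 0 -1ℤ 0ℤ drop₃ m₀ n₀ in attack (λ k {m} {n} _ h → safe n₀ k m n h) t wr
      where
      m₀ : ℕ
      m₀ = suc M ℕ.+ bd 0 -1ℤ

      drop₃ : ∀ {x y} → ∣ x ∣ ℕ.≤ N ℕ.+ N → ∣ y ∣ ℕ.≤ N ℕ.* B ℕ.+ N ℕ.* B → w x y ℤ.< 0ℤ → lin 0 -1ℤ x y ℤ.≤ 0ℤ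
      drop₃ {+ a} {y} _ _ _ = ≤-by (ℤ.+≤+ (z≤n {a})) (go (+ a) y)
        where
        go : ∀ a y → 0ℤ ℤ.- (0ℤ ℤ.* y ℤ.+ -1ℤ ℤ.* a) ≡ a ℤ.- 0ℤ
        go = solve-∀
      drop₃ { -[1+ a ]} {y} _ hy lt = ⊥-elim (ℤ.<⇒≱ lt nonneg)
        where
        Y : ℕ
        Y = N ℕ.* B ℕ.+ N ℕ.* B
        go : ∀ q y Y j a → q ℤ.* y ℤ.+ ℤ.- j ℤ.* (ℤ.- (1ℤ ℤ.+ a)) ℤ.- 0ℤ ≡
                           q ℤ.* y ℤ.+ j ℤ.+ j ℤ.* a ℤ.- (q ℤ.* (ℤ.- Y) ℤ.+ q ℤ.* Y ℤ.+ 0ℤ)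
        go = solve-∀
        nonneg : 0ℤ ℤ.≤ w -[1+ a ] y
        nonneg = ≤-by (ℤ.*-monoˡ-≤-nonNeg (+ Q) (ℤ.≤-trans (ℤ.neg-mono-≤ (ℤ.+≤+ hy)) (-∣i∣≤i y))
                        ⊞ subst (ℤ._≤ + j) (ℤ.pos-* Q Y) (ℤ.+≤+ hj) ⊞ subst (0ℤ ℤ.≤_) (ℤ.pos-* j a) (ℤ.+≤+ (z≤n {j ℕ.* a})))
                 (go (+ Q) y (+ Y) (+ j) (+ a))

      safe : ∀ n₀ k m n → lin 0 -1ℤ (+ m) (+ n) ℤ.≤ lin 0 -1ℤ (+ m₀) (+ n₀) ℤ.+ + k ℤ.* 0ℤ ℤ.+ + bd 0 -1ℤ → suc M ℕ.≤ m
      safe n₀ k m n h = ℤ.drop‿+≤+ (≤-by (subst₂ (λ u v → u ℤ.≤ v ℤ.+ + k ℤ.* 0ℤ ℤ.+ + bd 0 -1ℤ) (-m m n) (-m m₀ n₀) h)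
                          (go (+ m) (+ suc M) (+ k) (+ bd 0 -1ℤ)))
        where
        go : ∀ m s k b → m ℤ.- s ≡ ℤ.- (s ℤ.+ b) ℤ.+ k ℤ.* 0ℤ ℤ.+ b ℤ.- (ℤ.- m)
        go = solve-∀

-- Belts around the frontier.

module BeltTheorem (G : Game) (A : Set₁) (E : Arena G A) where
  open Game G
  open Classical A
  open Arena E
  open Adjacent (N ℕ.+ N)
  open Belts G A E
  open Attacks G A E using (Prev; module Attack)

  module Next (j : ℕ) (u : Fin N → Bool) where
    open Stage j u

    decide : ∀ r b → u r ≡ b → Bool → Bool
    decide r true  _  _     = true
    decide r false _  false = false
    decide r false eq true  = [ (λ _ → true) , (λ _ → false) ]′ (start r eq)

    next : Fin N → Bool
    next r = decide r (u r) refl (fin r)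

    decide-true : ∀ r b eq f → decide r b eq f ≡ true → u r ≡ true ⊎ DTree (replicate N nothing) r 0ℤ 0ℤ
    decide-true r true  eq f    h = inj₁ eq
    decide-true r false eq true h with start r eq
    ... | inj₁ t = inj₂ t

    decide-false : ∀ r b eq f → decide r b eq f ≡ false →
                   u r ≡ false × (f ≡ false ⊎ STree (replicate N nothing) r 0ℤ 0ℤ)
    decide-false r false eq false h = eq , inj₁ refl
    decide-false r false eq true  h with start r eq
    ... | inj₂ t = eq , inj₂ t

    next-true : ∀ {r} → next r ≡ true → u r ≡ true ⊎ DTree (replicate N nothing) r 0ℤ 0ℤ
    next-true {r} = decide-true r (u r) refl (fin r)

    next-false : ∀ {r} → next r ≡ false → u r ≡ false × (fin r ≡ false ⊎ STree (replicate N nothing) r 0ℤ 0ℤ)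
    next-false {r} = decide-false r (u r) refl (fin r)

  -- Collects the `fin` pairs whose first-cycle game Duplicator wins at some stage before `j`.
  U : ℕ → Fin N → Bool
  U zero    r = false
  U (suc j) r = Next.next j (U j) r

  mutual
    -- A position above the line of slope `(j + 1)/Q` is also above that of slope `j/Q`, so
    -- `upper j` applies.
    sink : ∀ j → Σ ℕ λ C → ∀ {r m n} → U j r ≡ true → + C ℤ.≤ ws j (+ m) (+ n) → W r m n
    sink zero    = 0 , λ ()
    sink (suc j) = proj₁ (upper j) , λ {_} {m} {n} ur le → proj₂ (upper j) ur
      (ℤ.≤-trans le (≤-by (ℤ.+≤+ (z≤n {m})) (go (+ Q ℤ.* + n) (+ j) (+ m))))
      where
      go : ∀ q j m → q ℤ.+ ℤ.- j ℤ.* m ℤ.- (q ℤ.+ ℤ.- (1ℤ ℤ.+ j) ℤ.* m) ≡ m ℤ.- 0ℤ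
      go = solve-∀

    upper : ∀ j → Σ ℕ λ C → ∀ {r m n} → U (suc j) r ≡ true → + C ℤ.≤ ws j (+ m) (+ n) → W r m n
    upper j = C , λ ur le → [ (λ ur′ → proj₂ (sink j) ur′ (ℤ.≤-trans (ℤ.+≤+ C₀≤C) le)) , (λ t → defence t le) ]′
                    (Next.next-true j (U j) ur)
      where
      open Stage.Defence j (U j) (proj₁ (sink j)) (proj₂ (sink j))
      C₀≤C : proj₁ (sink j) ℕ.≤ C
      C₀≤C = ℕ.≤-trans (ℕ.≤-trans (ℕ.m≤m+n (proj₁ (sink j)) Bs) (ℕ.m≤m+n _ (Q ℕ.* g))) (ℕ.m≤m+n _ (Stage.Bd j (U j)))

  prev : ∀ j → Prev j (U j)
  prev zero    = lift tt
  prev (suc j) e = let (M′ , h) = Attack.below-line j (U j) (prev j) e in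
    M′ , λ ur → h (proj₂ (Next.next-false j (U j) ur))

  record Belt (r : Fin N) : Set₁ where
    field
      sl  : ℕ
      C   : ℕ
      up  : ∀ {m n} → + C ℤ.≤ ws sl (+ m) (+ n) → W r m n
      low : ∀ {m n} → W r m n → ℤ.- (+ C) ℤ.≤ ws sl (+ m) (+ n) ⊎ A

  first : ∀ i r → U i r ≡ true → Σ ℕ λ j → U (suc j) r ≡ true × U j r ≡ false
  first (suc i) r h = go (U i r) refl
    where
    go : ∀ b → U i r ≡ b → Σ ℕ λ j → U (suc j) r ≡ true × U j r ≡ false
    go true  eq = first i r eq
    go false eq = i , h , eq

  -- A pair still outside at stage `j + 1` was won by Spoiler at stage `j`, and `far-below-next`
  -- speaks about the line one step steeper. For `j = 0` the value is `Q·n ≥ 0`.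
  lower : ∀ j {r} → fin r ≡ true → U j r ≡ false →
          Σ ℕ λ C → ∀ {m n} → W r m n → ℤ.- (+ C) ℤ.≤ ws j (+ m) (+ n) ⊎ A
  lower zero _ _ = 0 , λ {m} {n} _ → inj₁ (subst (0ℤ ℤ.≤_) (trans (ℤ.pos-* Q n) (go (+ Q ℤ.* + n) (+ m))) (ℤ.+≤+ (z≤n {Q ℕ.* n})))
    where
    go : ∀ q m → q ≡ q ℤ.+ ℤ.- 0ℤ ℤ.* m
    go = solve-∀
  lower (suc j) fr ur with Next.next-false j (U j) ur
  ... | _ , inj₁ ff with () ← trans (sym fr) ff
  ... | _ , inj₂ t = proj₁ below , λ {m} {n} wr → [ inj₁ , (λ le → inj₂ (proj₂ below t le wr)) ]′
                       (ℤ.≤-total (ℤ.- (+ proj₁ below)) (ws (suc j) (+ m) (+ n)))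
    where below = Attack.far-below-next j (U j) (prev j)

  -- By `steepest`, a `fin` pair is won by Duplicator at stage `top` at the latest. The first such
  -- stage gives the slope, with `upper` and `lower` as the two sides.
  belt : ∀ {r} → fin r ≡ true → Belt r ⊎ A
  belt {r} fr = go (U (suc top) r) refl
    where
    top : ℕ
    top = Q ℕ.* (N ℕ.* B ℕ.+ N ℕ.* B)

    go : ∀ b → U (suc top) r ≡ b → Belt r ⊎ A
    go true eq = let (j , ut , uf) = first (suc top) r eq ; (C₁ , up) = upper j ; (C₂ , lo) = lower j fr uf in
      inj₁ record
        { sl  = j
        ; C   = C₁ ℕ.+ C₂
        ; up  = λ le → up ut (ℤ.≤-trans (ℤ.+≤+ (ℕ.m≤m+n C₁ C₂)) le)
        ; low = λ wr → [ (λ le → inj₁ (ℤ.≤-trans (ℤ.neg-mono-≤ (ℤ.+≤+ (ℕ.m≤n+m C₂ C₁))) le)) , inj₂ ]′ (lo wr) }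
    go false eq with Next.next-false top (U top) eq
    ... | _ , inj₁ ff with () ← trans (sym fr) ff
    ... | _ , inj₂ t = inj₂ (Attack.steepest top (U top) (prev top) ℕ.≤-refl fr t)

-- Finite certificates for a periodic frontier.

-- A finite piece of Duplicator's frontier: tab r m is the least counter with which he wins
-- at (r , m), and lies within C/Q of the line of slope sl r / Q.
record Table (G : Game) : Set where
  open Game G
  field
    Q         : ℕ
    {{Q≢0}}   : ℕ.NonZero Q
    sl        : Fin N → ℕ
    S C M₀    : ℕ
    sl≤S      : ∀ r → sl r ℕ.≤ S
    gap       : C ℕ.+ C ℕ.+ Q ℕ.* K ℕ.+ S ℕ.< M₀

  Mtop : ℕ
  -- The columns from `M₀` to `Mtop` are one more than the vectors of `N` offsets in `0 … C + C`, as
  -- the pigeonhole principle requires.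
  Mtop = M₀ ℕ.+ suc (C ℕ.+ C) ℕ.^ N

  field
    fin       : Fin N → Bool
    tab       : Fin N → ℕ → Maybe ℕ
    tab-fin   : ∀ {r m} → fin r ≡ true → m ℕ.≤ Mtop → Σ ℕ λ f → tab r m ≡ just f ×
                sl r ℕ.* m ℕ.≤ Q ℕ.* f ℕ.+ C × Q ℕ.* f ℕ.≤ sl r ℕ.* m ℕ.+ C
    tab-inf   : ∀ {r m} → fin r ≡ false → M₀ ℕ.≤ m → m ℕ.≤ Mtop → tab r m ≡ nothing
    tab-resp  : ∀ {r m f} → tab r m ≡ just f → m ℕ.≤ Mtop → ∀ μ {m′} → Apply (eff r μ) m m′ → m′ ℕ.≤ Mtop →
                Σ (Fin N) λ r′ → Σ ℕ λ n′ → Σ ℕ λ f′ → Rsp r μ r′ f n′ × tab r′ m′ ≡ just f′ × f′ ℕ.≤ n′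

module Certificate (G : Game) (Tb : Table G) where
  open Game G
  open Table Tb

  tab-just : ∀ {r m f} → tab r m ≡ just f → M₀ ℕ.≤ m → m ℕ.≤ Mtop →
             fin r ≡ true × sl r ℕ.* m ℕ.≤ Q ℕ.* f ℕ.+ C × Q ℕ.* f ℕ.≤ sl r ℕ.* m ℕ.+ C
  tab-just {r} {m} {f} eq lo hi with fin r in fe
  ... | false with () ← trans (sym (tab-inf fe lo hi)) eq
  ... | true with tab-fin fe hi
  ... | f′ , eq′ , l , h with refl ← just-injective (trans (sym eq) eq′) = refl , l , h

  -- The distance to the line, raised by `C` so that the subtraction does not truncate on a belt.
  -- The default 0 causes no confusion, since from `M₀` on `fin r` alone decides whether an entry
  -- exists.
  offset : Fin N → ℕ → ℕ
  offset r m with tab r m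
  ... | nothing = 0
  ... | just f  = Q ℕ.* f ℕ.+ C ℕ.∸ sl r ℕ.* m

  offset-just : ∀ {r m f} → tab r m ≡ just f → offset r m ≡ Q ℕ.* f ℕ.+ C ℕ.∸ sl r ℕ.* m
  offset-just {r} {m} eq rewrite eq = refl

  offset-bound : ∀ r m → M₀ ℕ.≤ m → m ℕ.≤ Mtop → offset r m ℕ.≤ C ℕ.+ C
  offset-bound r m lo hi with tab r m in eq
  ... | nothing = z≤n
  ... | just f with tab-just eq lo hi
  ... | _ , _ , h = ℕ.m≤n+o⇒m∸n≤o (Q ℕ.* f ℕ.+ C) (sl r ℕ.* m) (ℕ.≤-trans (ℕ.+-monoˡ-≤ C h) (ℕ.≤-reflexive (ℕ.+-assoc (sl r ℕ.* m) C C)))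

  V : ℕ
  V = suc (C ℕ.+ C) ℕ.^ N

  column : Fin (suc V) → ℕ
  column i = M₀ ℕ.+ toℕ i

  column≤ : ∀ i → column i ℕ.≤ Mtop
  column≤ i = ℕ.+-monoʳ-≤ M₀ (ℕ.≤-pred (Fin.toℕ<n i))

  offsets : Fin (suc V) → Fin N → Fin (suc (C ℕ.+ C))
  offsets i r = fromℕ< (s≤s (offset-bound r (column i) (ℕ.m≤m+n M₀ _) (column≤ i)))

  repetition : Σ ℕ λ m₁ → Σ ℕ λ p → M₀ ℕ.≤ m₁ × suc p ℕ.+ m₁ ℕ.≤ Mtop × (∀ r → offset r m₁ ≡ offset r (suc p ℕ.+ m₁))
  repetition with Fin.pigeonhole (ℕ.n<1+n V) (λ i → funToFin (offsets i))
  ... | i , j , i<j , eq = column i , p , ℕ.m≤m+n M₀ _ , subst (ℕ._≤ Mtop) (sym step-eq) (column≤ j) ,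
        λ r → trans (same r) (cong (offset r) (sym step-eq))
    where
    p : ℕ
    p = toℕ j ℕ.∸ suc (toℕ i)
    step-eq : suc p ℕ.+ column i ≡ column j
    step-eq = trans (go p M₀ (toℕ i)) (cong (M₀ ℕ.+_) (ℕ.m∸n+n≡m i<j))
      where
      go : ∀ p m i → suc p ℕ.+ (m ℕ.+ i) ≡ m ℕ.+ (p ℕ.+ suc i)
      go = ℕ.solve-∀
    at : ∀ i r → toℕ (finToFun (funToFin (offsets i)) r) ≡ offset r (column i)
    at i r = trans (cong toℕ (Fin.finToFun-funToFin (offsets i) r)) (Fin.toℕ-fromℕ< _)
    same : ∀ r → offset r (column i) ≡ offset r (column j)
    same r = trans (sym (at i r)) (trans (cong (λ z → toℕ (finToFun z r)) eq) (at j r))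

  module Periodic (m₁ p₀ : ℕ) (M₀≤m₁ : M₀ ℕ.≤ m₁) (m₂≤ : suc p₀ ℕ.+ m₁ ℕ.≤ Mtop)
                  (same : ∀ r → offset r m₁ ≡ offset r (suc p₀ ℕ.+ m₁)) where

    p m₂ : ℕ
    p  = suc p₀
    m₂ = p ℕ.+ m₁

    M₀≤m₂ : M₀ ℕ.≤ m₂
    M₀≤m₂ = ℕ.≤-trans M₀≤m₁ (ℕ.m≤n+m m₁ p)

    value : Maybe ℕ → ℕ
    value nothing  = 0
    value (just f) = f

    rise : Fin N → ℕ
    rise r = value (tab r m₂) ℕ.∸ value (tab r m₁)

    -- Equal offsets in the two columns cancel, so the rise over one period is exactly that of the
    -- line; in particular it is monotone in the slope.
    periodic : ∀ {r} → fin r ≡ true → Σ ℕ λ f → tab r m₁ ≡ just f × tab r m₂ ≡ just (f ℕ.+ rise r) × Q ℕ.* rise r ≡ sl r ℕ.* p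
    periodic {r} fr with tab-fin fr (ℕ.≤-trans (ℕ.m≤n+m m₁ p) m₂≤) | tab-fin fr m₂≤
    ... | f₁ , eq₁ , l₁ , h₁ | f₂ , eq₂ , l₂ , h₂ =
          f₁ , eq₁ , trans eq₂ (cong just f₂≡) , ℕ.+-cancelˡ-≡ (Q ℕ.* f₁) _ _ (trans (sym (ℕ.*-distribˡ-+ Q f₁ (rise r))) (trans (cong (Q ℕ.*_) (sym f₂≡)) Qf₂))
      where
      o : ℕ
      o = offset r m₁
      e₁ : Q ℕ.* f₁ ℕ.+ C ≡ o ℕ.+ sl r ℕ.* m₁
      e₁ = trans (sym (ℕ.m∸n+n≡m l₁)) (cong (ℕ._+ sl r ℕ.* m₁) (sym (offset-just eq₁)))
      e₂ : Q ℕ.* f₂ ℕ.+ C ≡ o ℕ.+ sl r ℕ.* m₂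
      e₂ = trans (sym (ℕ.m∸n+n≡m l₂)) (cong (ℕ._+ sl r ℕ.* m₂) (trans (sym (offset-just eq₂)) (sym (same r))))
      go : ∀ o s p m → o ℕ.+ s ℕ.* (p ℕ.+ m) ≡ o ℕ.+ s ℕ.* m ℕ.+ s ℕ.* p
      go = ℕ.solve-∀
      go′ : ∀ a c b → a ℕ.+ c ℕ.+ b ≡ a ℕ.+ b ℕ.+ c
      go′ = ℕ.solve-∀
      Qf₂ : Q ℕ.* f₂ ≡ Q ℕ.* f₁ ℕ.+ sl r ℕ.* p
      Qf₂ = ℕ.+-cancelʳ-≡ C _ _ (trans e₂ (trans (go o (sl r) p m₁) (trans (cong (ℕ._+ sl r ℕ.* p) (sym e₁)) (go′ (Q ℕ.* f₁) C (sl r ℕ.* p)))))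
      f₁≤f₂ : f₁ ℕ.≤ f₂
      f₁≤f₂ = ℕ.*-cancelˡ-≤ Q (subst (Q ℕ.* f₁ ℕ.≤_) (sym Qf₂) (ℕ.m≤m+n _ _))
      f₂≡ : f₂ ≡ f₁ ℕ.+ rise r
      f₂≡ = trans (sym (ℕ.m+[n∸m]≡n f₁≤f₂)) (cong (f₁ ℕ.+_) (cong₂ ℕ._∸_ (cong value (sym eq₂)) (cong value (sym eq₁))))

    rise-mono : ∀ {r r′} → fin r ≡ true → fin r′ ≡ true → sl r′ ℕ.≤ sl r → rise r′ ℕ.≤ rise r
    rise-mono {r} {r′} fr fr′ le = ℕ.*-cancelˡ-≤ Q (subst₂ ℕ._≤_ (sym (proj₂ (proj₂ (proj₂ (periodic fr′))))) (sym (proj₂ (proj₂ (proj₂ (periodic fr))))) (ℕ.*-monoˡ-≤ p le))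

    -- Beyond M₀ the belts of different slopes are too far apart for a bounded response to climb.
    no-climb : ∀ {r r′ m m′ f f′} → sl r ℕ.* m ℕ.+ C ℕ.≥ Q ℕ.* f → sl r′ ℕ.* m′ ℕ.≤ Q ℕ.* f′ ℕ.+ C →
               f′ ℕ.≤ f ℕ.+ K → m ℕ.≤ suc m′ → M₀ ℕ.≤ m′ → sl r′ ℕ.≤ sl r
    no-climb {r} {r′} {m} {m′} {f} {f′} hi lo f′≤ m≤ M₀≤ with sl r′ ℕ.≤? sl r
    ... | yes le = le
    ... | no ≰ = ⊥-elim (ℕ.<⇒≱ (ℕ.<-≤-trans gap M₀≤) (ℕ.+-cancelˡ-≤ (sl r ℕ.* m′) _ _ chain))
      where
      open ℕ.≤-Reasoning
      chain : sl r ℕ.* m′ ℕ.+ m′ ℕ.≤ sl r ℕ.* m′ ℕ.+ (C ℕ.+ C ℕ.+ Q ℕ.* K ℕ.+ S)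
      chain = begin
        sl r ℕ.* m′ ℕ.+ m′                             ≡⟨ ℕ.+-comm (sl r ℕ.* m′) m′ ⟩
        suc (sl r) ℕ.* m′                               ≤⟨ ℕ.*-monoˡ-≤ m′ (ℕ.≰⇒> ≰) ⟩
        sl r′ ℕ.* m′                                    ≤⟨ lo ⟩
        Q ℕ.* f′ ℕ.+ C                                 ≤⟨ ℕ.+-monoˡ-≤ C (ℕ.*-monoʳ-≤ Q f′≤) ⟩
        Q ℕ.* (f ℕ.+ K) ℕ.+ C                         ≡⟨ cong (ℕ._+ C) (ℕ.*-distribˡ-+ Q f K) ⟩
        Q ℕ.* f ℕ.+ Q ℕ.* K ℕ.+ C                    ≤⟨ ℕ.+-monoˡ-≤ C (ℕ.+-monoˡ-≤ (Q ℕ.* K) hi) ⟩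
        sl r ℕ.* m ℕ.+ C ℕ.+ Q ℕ.* K ℕ.+ C          ≤⟨ ℕ.+-monoˡ-≤ C (ℕ.+-monoˡ-≤ (Q ℕ.* K) (ℕ.+-monoˡ-≤ C (ℕ.*-monoʳ-≤ (sl r) m≤))) ⟩
        sl r ℕ.* suc m′ ℕ.+ C ℕ.+ Q ℕ.* K ℕ.+ C     ≡⟨ go (sl r) m′ C (Q ℕ.* K) ⟩
        sl r ℕ.* m′ ℕ.+ (C ℕ.+ C ℕ.+ Q ℕ.* K ℕ.+ sl r) ≤⟨ ℕ.+-monoʳ-≤ (sl r ℕ.* m′) (ℕ.+-monoʳ-≤ (C ℕ.+ C ℕ.+ Q ℕ.* K) (sl≤S r)) ⟩
        sl r ℕ.* m′ ℕ.+ (C ℕ.+ C ℕ.+ Q ℕ.* K ℕ.+ S) ∎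
        where
        go : ∀ s m c q → s ℕ.* suc m ℕ.+ c ℕ.+ q ℕ.+ c ≡ s ℕ.* m ℕ.+ (c ℕ.+ c ℕ.+ q ℕ.+ s)
        go = ℕ.solve-∀

    -- The frontier on [m₁ , m₂] continued periodically.
    data Cert (r : Fin N) : ℕ → ℕ → Set where
      cert : ∀ t {m f n} → m ℕ.≤ m₂ → tab r m ≡ just f → t ≡ 0 ⊎ m₁ ℕ.≤ m → f ℕ.+ t ℕ.* rise r ℕ.≤ n →
             Cert r (m ℕ.+ t ℕ.* p) n

    Answer : ∀ r → Fin (moves r) → ℕ → ℕ → Set
    Answer r μ m′ n = Σ (Fin N) λ r′ → Σ ℕ λ n′ → Rsp r μ r′ n n′ × Cert r′ m′ n′

    apply-pred : ∀ {d m m′} → Apply d m m′ → m ℕ.≤ suc m′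
    apply-pred app-dec = ℕ.≤-refl
    apply-pred app-zer = ℕ.n≤1+n _
    apply-pred app-inc = ℕ.≤-trans (ℕ.n≤1+n _) (ℕ.n≤1+n _)

    -- The response of the table is shifted by `t` periods. If it is bounded, `no-climb` makes the
    -- new slope no steeper, so the shift covers the required rise; if it is unbounded, a large
    -- enough counter is chosen.
    respond : ∀ t {r m m′ f n} μ → Apply (eff r μ) m m′ → m ℕ.≤ m₂ → m′ ℕ.≤ m₂ → tab r m ≡ just f →
              t ≡ 0 ⊎ (m₁ ℕ.≤ m × m₁ ℕ.≤ m′) → f ℕ.+ t ℕ.* rise r ℕ.≤ n → Answer r μ (m′ ℕ.+ t ℕ.* p) n
    respond t {r} {m} {m′} {f} {n} μ ap m≤ m′≤ eq pos f≤n with tab-resp eq (ℕ.≤-trans m≤ m₂≤) μ ap (ℕ.≤-trans m′≤ m₂≤)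
    ... | r′ , n′ , f′ , ρ , eq′ , f′≤n′ = finish pos (gain ρ)
      where
      i : ℕ
      i = n ℕ.∸ (f ℕ.+ t ℕ.* rise r)

      n≡ : i ℕ.+ t ℕ.* rise r ℕ.+ f ≡ n
      n≡ = trans (go i (t ℕ.* rise r) f) (ℕ.m∸n+n≡m f≤n)
        where
        go : ∀ i t f → i ℕ.+ t ℕ.+ f ≡ i ℕ.+ (f ℕ.+ t)
        go = ℕ.solve-∀

      direct : t ≡ 0 ⊎ m₁ ℕ.≤ m′ → t ℕ.* rise r′ ℕ.≤ t ℕ.* rise r → Answer r μ (m′ ℕ.+ t ℕ.* p) n
      direct q le = r′ , i ℕ.+ t ℕ.* rise r ℕ.+ n′ , subst (λ z → Rsp r μ r′ z (i ℕ.+ t ℕ.* rise r ℕ.+ n′)) n≡ (shift (i ℕ.+ t ℕ.* rise r) ρ) ,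
        cert t m′≤ eq′ q (ℕ.≤-trans (ℕ.+-mono-≤ f′≤n′ le) (ℕ.≤-trans (ℕ.m≤n+m _ i) (ℕ.≤-reflexive (go i n′ (t ℕ.* rise r)))))
        where
        go : ∀ i n t → i ℕ.+ (n ℕ.+ t) ≡ i ℕ.+ t ℕ.+ n
        go = ℕ.solve-∀

      finish : t ≡ 0 ⊎ (m₁ ℕ.≤ m × m₁ ℕ.≤ m′) → n′ ℕ.≤ f ℕ.+ K ⊎ Unbounded r μ r′ f → Answer r μ (m′ ℕ.+ t ℕ.* p) n
      finish (inj₁ refl) _ = direct (inj₁ refl) z≤n
      finish (inj₂ (_ , m₁≤m′)) (inj₂ un) with unbounded-mono (ℕ.≤-trans (ℕ.m≤m+n f _) f≤n) un (f′ ℕ.+ t ℕ.* rise r′)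
      ... | l , le , ρ′ = r′ , l , ρ′ , cert t m′≤ eq′ (inj₂ m₁≤m′) le
      finish (inj₂ (m₁≤m , m₁≤m′)) (inj₁ n′≤) =
        let (fr  , _  , hi) = tab-just eq  (ℕ.≤-trans M₀≤m₁ m₁≤m)  (ℕ.≤-trans m≤ m₂≤)
            (fr′ , lo , _)  = tab-just eq′ (ℕ.≤-trans M₀≤m₁ m₁≤m′) (ℕ.≤-trans m′≤ m₂≤)
            sl≤ = no-climb {r} {r′} {m} {m′} {f} {f′} hi lo (ℕ.≤-trans f′≤n′ n′≤) (apply-pred ap) (ℕ.≤-trans M₀≤m₁ m₁≤m′)
        in direct (inj₂ m₁≤m′) (ℕ.*-monoʳ-≤ t (rise-mono fr fr′ sl≤))

    -- The column `m₂ + t·p` is also `m₁ + (t + 1)·p`; `up` and `down` pass between these two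
    -- representations.
    up : ∀ t {r f n} → tab r m₂ ≡ just f → f ℕ.+ t ℕ.* rise r ℕ.≤ n →
         Σ ℕ λ f′ → tab r m₁ ≡ just f′ × f′ ℕ.+ suc t ℕ.* rise r ℕ.≤ n
    up t {r} {n = n} eq le with periodic (proj₁ (tab-just eq M₀≤m₂ m₂≤))
    ... | f′ , e₁ , e₂ , _ with refl ← just-injective (trans (sym eq) e₂) = f′ , e₁ , subst (ℕ._≤ n) (ℕ.+-assoc f′ (rise r) (t ℕ.* rise r)) le

    down : ∀ t {r f n} → tab r m₁ ≡ just f → f ℕ.+ suc t ℕ.* rise r ℕ.≤ n →
           Σ ℕ λ f′ → tab r m₂ ≡ just f′ × f′ ℕ.+ t ℕ.* rise r ℕ.≤ n
    down t {r} {n = n} eq le with periodic (proj₁ (tab-just eq M₀≤m₁ (ℕ.≤-trans (ℕ.m≤n+m m₁ p) m₂≤)))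
    ... | f′ , e₁ , e₂ , _ with refl ← just-injective (trans (sym eq) e₁) = f′ ℕ.+ rise r , e₂ , subst (ℕ._≤ n) (sym (ℕ.+-assoc f′ (rise r) (t ℕ.* rise r))) le

    -- For `t > 0` the window is left only by an increment at `m₂` or a decrement at `m₁`, and then
    -- the position is re-represented at the other end first. The effect `d` is a separate argument
    -- so that it can be matched on.
    answer : ∀ d t {r m f n m′} μ → eff r μ ≡ d → m ℕ.≤ m₂ → tab r m ≡ just f → t ≡ 0 ⊎ m₁ ℕ.≤ m →
             f ℕ.+ t ℕ.* rise r ℕ.≤ n → Apply d (m ℕ.+ t ℕ.* p) m′ → Answer r μ m′ n
    answer zer t μ de m≤ eq q le app-zer = respond t μ (subst (λ z → Apply z _ _) (sym de) app-zer) m≤ m≤ eq (map₂ (λ x → x , x) q) le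
    answer inc t {r} {m} {n = n} μ de m≤ eq q le app-inc with ℕ.m≤n⇒m<n∨m≡n m≤
    ... | inj₁ m<m₂ = respond t μ (subst (λ z → Apply z _ _) (sym de) app-inc) m≤ m<m₂ eq (map₂ (λ x → x , ℕ.m≤n⇒m≤1+n x) q) le
    ... | inj₂ refl with up t eq le
    ...   | f′ , eq′ , le′ = subst (λ z → Answer r μ z n) (cong suc (go m₁ p (t ℕ.* p)))
              (respond (suc t) μ (subst (λ z → Apply z _ _) (sym de) app-inc) (ℕ.m≤n+m m₁ p) (s≤s (ℕ.m≤n+m m₁ p₀)) eq′
                (inj₂ (ℕ.≤-refl , ℕ.n≤1+n m₁)) le′)
      where
      go : ∀ m p t → m ℕ.+ (p ℕ.+ t) ≡ p ℕ.+ m ℕ.+ t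
      go = ℕ.solve-∀
    answer dec zero {m = suc m} μ de m≤ eq q le app-dec =
      respond zero μ (subst (λ z → Apply z _ _) (sym de) app-dec) m≤ (ℕ.≤-trans (ℕ.n≤1+n m) m≤) eq (inj₁ refl) le
    answer dec (suc t) {m = m} μ de m≤ eq (inj₂ m₁≤m) le ap with ℕ.m≤n⇒m<n∨m≡n m₁≤m
    answer dec (suc t) {m = suc m} μ de m≤ eq (inj₂ m₁≤m) le app-dec | inj₁ (s≤s m₁≤) =
      respond (suc t) μ (subst (λ z → Apply z _ _) (sym de) app-dec) m≤ (ℕ.≤-trans (ℕ.n≤1+n m) m≤) eq (inj₂ (m₁≤m , m₁≤)) le
    answer dec (suc t) {r} {m} {n = n} {m′} μ de m≤ eq (inj₂ m₁≤m) le ap | inj₂ refl with down t eq le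
    ... | f′ , eq′ , le′ = subst (λ z → Answer r μ z n) target
            (respond t μ (subst (λ z → Apply z m₂ (ℕ.pred m₂)) (sym de) app-dec) ℕ.≤-refl (ℕ.n≤1+n _) eq′
              (inj₂ (ℕ.m≤n+m m₁ p , ℕ.m≤n+m m₁ _)) le′)
      where
      go : ∀ m p t → p ℕ.+ m ℕ.+ t ≡ m ℕ.+ (p ℕ.+ t)
      go = ℕ.solve-∀
      target : ℕ.pred m₂ ℕ.+ t ℕ.* p ≡ m′
      target = apply-unique (apply-shift (t ℕ.* p) (app-dec {ℕ.pred m₂})) (subst (λ z → Apply dec z m′) (sym (go m₁ p (t ℕ.* p))) ap)

    Cert-sim : Sim Cert
    Cert-sim r _ _ (cert t m≤ eq q le) μ _ ap = answer (eff r μ) t μ refl m≤ eq q le ap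

    Cert-table : ∀ {r m f n} → m ℕ.≤ M₀ → tab r m ≡ just f → f ℕ.≤ n → Cert r m n
    Cert-table {r} {m} {f} m≤ eq le = subst (λ z → Cert r z _) (ℕ.+-identityʳ m)
      (cert 0 (ℕ.≤-trans m≤ M₀≤m₂) eq (inj₁ refl) (ℕ.≤-trans (ℕ.≤-reflexive (ℕ.+-identityʳ f)) le))

  certificate : ∀ {r m f n} → m ℕ.≤ M₀ → tab r m ≡ just f → f ℕ.≤ n →
                Σ (Fin N → ℕ → ℕ → Set) λ R → Sim R × R r m n
  certificate m≤ eq le with repetition
  ... | m₁ , p₀ , M₀≤m₁ , m₂≤ , same = Cert , Cert-sim , Cert-table m≤ eq le
    where open Periodic m₁ p₀ M₀≤m₁ m₂≤ same

-- Extraction of a table from the classical argument.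

slope-lower : ∀ Q j C m f → ℤ.- (+ C) ℤ.≤ slope Q j (+ m) (+ f) → j ℕ.* m ℕ.≤ Q ℕ.* f ℕ.+ C
slope-lower Q j C m f le = ℤ.drop‿+≤+ (subst₂ ℤ._≤_ (sym (ℤ.pos-* j m)) (cong (ℤ._+ + C) (sym (ℤ.pos-* Q f)))
  (≤-by le (go (+ Q ℤ.* + f) (+ j) (+ m) (+ C))))
  where
  go : ∀ q j m c → q ℤ.+ c ℤ.- j ℤ.* m ≡ q ℤ.+ ℤ.- j ℤ.* m ℤ.- (ℤ.- c)
  go = solve-∀

slope-upper : ∀ Q j C m f → slope Q j (+ m) (+ f) ℤ.≤ + C → Q ℕ.* f ℕ.≤ j ℕ.* m ℕ.+ C
slope-upper Q j C m f le = ℤ.drop‿+≤+ (subst₂ ℤ._≤_ (sym (ℤ.pos-* Q f)) (cong (ℤ._+ + C) (sym (ℤ.pos-* j m)))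
  (≤-by le (go (+ Q ℤ.* + f) (+ j) (+ m) (+ C))))
  where
  go : ∀ q j m c → j ℤ.* m ℤ.+ c ℤ.- q ≡ c ℤ.- (q ℤ.+ ℤ.- j ℤ.* m)
  go = solve-∀

module Extraction (G : Game) (A : Set₁) (E : Arena G A) where
  open Game G
  open Classical A
  open Arena E
  open Adjacent (N ℕ.+ N) using (Q)
  open Belts G A E using (ws; Q≢0)
  open BeltTheorem G A E using (Belt; belt)

  Cell : Fin N → ℕ → Maybe ℕ → Set₁
  Cell r m nothing  = ∀ n → W r m n → A
  Cell r m (just f) = W r m f × (∀ n → n ℕ.< f → W r m n → A)

  cell : ∀ r m → T (Σ (Maybe ℕ) (Cell r m))
  cell r m = lem (Σ ℕ (W r m)) >>= λ
    { (inj₂ ¬w)      → return (nothing , λ n wr → ¬w (n , wr))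
    ; (inj₁ (n , wr)) → <-rec P least n wr }
    where
    P : ℕ → Set₁
    P n = W r m n → T (Σ (Maybe ℕ) (Cell r m))
    least : ∀ n → (∀ {n′} → n′ ℕ.< n → P n′) → P n
    least n rec wr = lem (Σ ℕ λ n′ → n′ ℕ.< n × W r m n′) >>= λ
      { (inj₁ (n′ , lt , wr′)) → rec lt wr′
      ; (inj₂ ¬w) → return (just n , wr , λ n′ lt wr′ → ¬w (n′ , lt , wr′)) }

  Belt? : Fin N → Set₁
  Belt? r = fin r ≡ false ⊎ Belt r

  belt? : ∀ r → T (Belt? r)
  belt? r with fin r in fe
  ... | false = return (inj₁ refl)
  ... | true  = orElse (belt fe) >>= λ b → return (inj₂ b)

  slopeOf widthOf : ∀ {r} → Belt? r → ℕ
  slopeOf (inj₁ _) = 0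
  slopeOf (inj₂ b) = Belt.sl b
  widthOf (inj₁ _) = 0
  widthOf (inj₂ b) = Belt.C b

  module WithBelts (belts : ∀ r → Belt? r) (m₀ : ℕ) where

    sl : Fin N → ℕ
    sl r = slopeOf (belts r)

    C₁ C S M₀ Mtop : ℕ
    C₁ = maxF (λ r → widthOf (belts r))
    -- The upper side of the belt bounds the losing counter just below the least winning one; the
    -- step between them costs `Q`.
    C = C₁ ℕ.+ Q
    S = maxF sl
    -- Large enough to contain the queried column `m₀`, to apply `fin-false`, and to satisfy `gap`.
    M₀ = m₀ ℕ.+ M ℕ.+ suc (C ℕ.+ C ℕ.+ Q ℕ.* K ℕ.+ S)
    Mtop = M₀ ℕ.+ suc (C ℕ.+ C) ℕ.^ N

    Cells : (Fin N → ℕ → Maybe ℕ) → Set₁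
    Cells tab = ∀ r m → m ℕ.≤ Mtop → Cell r m (tab r m)

    cells : T (Σ (Fin N → ℕ → Maybe ℕ) Cells)
    cells = ∀T-Fin N (λ r → choice-≤ Mtop (cell r)) >>= λ c → return ((λ r → proj₁ (c r)) , λ r → proj₂ (c r))

    Bounds : Fin N → ℕ → ℕ → Set
    Bounds r m f = sl r ℕ.* m ℕ.≤ Q ℕ.* f ℕ.+ C × Q ℕ.* f ℕ.≤ sl r ℕ.* m ℕ.+ C

    bounds : ∀ {r m f} → fin r ≡ true → Cell r m (just f) → T (Bounds r m f)
    bounds {r} {m} {f} fr (wr , least) = go (belts r) (≤maxF (λ r → widthOf (belts r)) r)
      where
      go : (b : Belt? r) → widthOf b ℕ.≤ C₁ →
           T (slopeOf b ℕ.* m ℕ.≤ Q ℕ.* f ℕ.+ C × Q ℕ.* f ℕ.≤ slopeOf b ℕ.* m ℕ.+ C)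
      go (inj₁ ff) _ with () ← trans (sym fr) ff
      go (inj₂ b) C≤ = orElse (Belt.low b wr) >>= λ lo → orElse (upper f least) >>= λ hi →
        return (ℕ.≤-trans (slope-lower Q j (Belt.C b) m f lo) (ℕ.+-monoʳ-≤ (Q ℕ.* f) Cb≤C) , hi)
        where
        j : ℕ
        j = Belt.sl b
        Cb≤C : Belt.C b ℕ.≤ C
        Cb≤C = ℕ.≤-trans C≤ (ℕ.m≤m+n C₁ Q)
        upper : ∀ f → (∀ n → n ℕ.< f → W r m n → A) → Q ℕ.* f ℕ.≤ j ℕ.* m ℕ.+ C ⊎ A
        upper zero    _     = inj₁ (ℕ.≤-trans (ℕ.≤-reflexive (ℕ.*-zeroʳ Q)) z≤n)
        upper (suc f) least = [ (λ le → inj₁ (begin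
            Q ℕ.* suc f                      ≡⟨ ℕ.*-suc Q f ⟩
            Q ℕ.+ Q ℕ.* f                   ≤⟨ ℕ.+-monoʳ-≤ Q (ℕ.≤-trans (slope-upper Q j (Belt.C b) m f le) (ℕ.+-monoʳ-≤ (j ℕ.* m) C≤)) ⟩
            Q ℕ.+ (j ℕ.* m ℕ.+ C₁)         ≡⟨ ℕ.+-comm Q _ ⟩
            j ℕ.* m ℕ.+ C₁ ℕ.+ Q           ≡⟨ ℕ.+-assoc (j ℕ.* m) C₁ Q ⟩
            j ℕ.* m ℕ.+ C                   ∎))
          , (λ ge → inj₂ (least f ℕ.≤-refl (Belt.up b ge))) ]′ (ℤ.≤-total (ws j (+ m) (+ f)) (+ Belt.C b))
          where open ℕ.≤-Reasoning

    module WithCells (tab : Fin N → ℕ → Maybe ℕ) (cs : Cells tab) where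

      -- These statements do not mention `A`, and finitely many instances suffice; once `T` is
      -- pulled out of them, they form a `Table` of genuine data.
      TabFin TabInf TabResp : Fin N → ℕ → Set
      TabFin r m  = fin r ≡ true → Σ ℕ λ f → tab r m ≡ just f × Bounds r m f
      TabInf r m  = fin r ≡ false → M₀ ℕ.≤ m → tab r m ≡ nothing
      TabResp r m = ∀ μ f → tab r m ≡ just f → ∀ m′ → Apply (eff r μ) m m′ → m′ ℕ.≤ Mtop →
        Σ (Fin N) λ r′ → Σ ℕ λ n′ → Σ ℕ λ f′ → Rsp r μ r′ f n′ × tab r′ m′ ≡ just f′ × f′ ℕ.≤ n′

      below : ∀ {r m n} x → Cell r m x → W r m n → T (Σ ℕ λ f → x ≡ just f × f ℕ.≤ n)
      below {n = n} nothing  ¬w          wr _ = ¬w n wr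
      below {n = n} (just f) (_ , least) wr = [ (λ le → return (f , refl , le)) , (λ lt _ → least n lt wr) ]′ (ℕ.≤-<-connex f n)

      tabFin : ∀ r m → m ℕ.≤ Mtop → T (TabFin r m)
      tabFin r m m≤ with fin r in fe
      ... | false = return λ ()
      ... | true  = fin-true fe m >>= λ (n , wr) → below (tab r m) (cs r m m≤) wr >>= λ (f , eq , _) →
                    bounds fe (subst (Cell r m) eq (cs r m m≤)) >>= λ bd → return λ _ → f , eq , bd

      tabInf : ∀ r m → m ℕ.≤ Mtop → T (TabInf r m)
      tabInf r m m≤ with tab r m in eq | M₀ ℕ.≤? m | fin r in fe
      ... | nothing | _      | _     = return λ _ _ → refl
      ... | just f  | no ≰   | _     = return λ _ le → ⊥-elim (≰ le)
      ... | just f  | _      | true  = return λ ()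
      ... | just f  | yes le | false = λ _ → fin-false fe (ℕ.≤-trans (ℕ.≤-trans (ℕ.m≤n+m M m₀) (ℕ.m≤m+n _ _)) le)
                                               (proj₁ (subst (Cell r m) eq (cs r m m≤)))

      tabResp : ∀ r m → m ℕ.≤ Mtop → T (TabResp r m)
      tabResp r m m≤ = ∀T-Fin (moves r) at
        where
        Goal : Fin (moves r) → Maybe ℕ → Set
        Goal μ x = ∀ f → x ≡ just f → ∀ m′ → Apply (eff r μ) m m′ → m′ ℕ.≤ Mtop →
          Σ (Fin N) λ r′ → Σ ℕ λ n′ → Σ ℕ λ f′ → Rsp r μ r′ f n′ × tab r′ m′ ≡ just f′ × f′ ℕ.≤ n′
        go : ∀ μ x → Cell r m x → T (Goal μ x)
        go μ nothing  _  = return λ _ ()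
        go μ (just f) (wr , _) with apply? (eff r μ) m
        ... | inj₂ stuck = return λ _ _ _ ap → ⊥-elim (stuck _ ap)
        ... | inj₁ (m′ , ap) with m′ ℕ.≤? Mtop
        ... | no ≰ = return λ _ _ _ ap′ le → ⊥-elim (≰ (subst (ℕ._≤ Mtop) (apply-unique ap′ ap) le))
        ... | yes m′≤ = W-sim wr μ ap >>= λ (r′ , n′ , ρ , wr′) →
              below (tab r′ m′) (cs r′ m′ m′≤) wr′ >>= λ (f′ , eq , le) →
              return λ { _ refl _ ap′ _ → r′ , n′ , f′ , ρ , subst (λ z → tab r′ z ≡ just f′) (apply-unique ap ap′) eq , le }
        at : ∀ μ → T (Goal μ (tab r m))
        at μ = go μ (tab r m) (cs r m m≤)

      everywhere : {P : Fin N → ℕ → Set} → (∀ r m → m ℕ.≤ Mtop → T (P r m)) → T (∀ r m → m ℕ.≤ Mtop → P r m)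
      everywhere {P} h = ∀T-Fin N λ r → ∀T-≤ Mtop {P = λ m → m ℕ.≤ Mtop → P r m} (decided r) >>= λ f → return λ m le → f m le le
        where
        decided : ∀ r m → T (m ℕ.≤ Mtop → P r m)
        decided r m with m ℕ.≤? Mtop
        ... | yes le = h r m le >>= λ x → return λ _ → x
        ... | no ≰   = return λ le → ⊥-elim (≰ le)

      table : (∀ r m → m ℕ.≤ Mtop → TabFin r m) → (∀ r m → m ℕ.≤ Mtop → TabInf r m) →
              (∀ r m → m ℕ.≤ Mtop → TabResp r m) → Table G
      table tf ti tr = record
        { Q = Q ; Q≢0 = Q≢0 ; sl = sl ; S = S ; C = C ; M₀ = M₀ ; sl≤S = ≤maxF sl
        ; gap = ℕ.m≤n+m _ (m₀ ℕ.+ M) ; fin = fin ; tab = tab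
        ; tab-fin = λ fr le → tf _ _ le fr
        ; tab-inf = λ fr lo hi → ti _ _ hi fr lo
        ; tab-resp = λ eq le μ → tr _ _ le μ _ eq _ }

      simulation : ∀ {r n} → W r m₀ n → T (Σ (Fin N → ℕ → ℕ → Set) λ R → Sim R × R r m₀ n)
      simulation {r} {n} wr =
        everywhere tabFin >>= λ tf → everywhere tabInf >>= λ ti → everywhere tabResp >>= λ tr →
        below (tab r m₀) (cs r m₀ (ℕ.≤-trans m₀≤M₀ (ℕ.m≤m+n M₀ _))) wr >>= λ (f , eq , f≤n) →
        return (Certificate.certificate G (table tf ti tr) m₀≤M₀ eq f≤n)
        where
        m₀≤M₀ : m₀ ℕ.≤ M₀
        m₀≤M₀ = ℕ.≤-trans (ℕ.m≤m+n m₀ M) (ℕ.m≤m+n (m₀ ℕ.+ M) _)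

  extract : ∀ {r m n} → W r m n → T (Σ (Fin N → ℕ → ℕ → Set) λ R → Sim R × R r m n)
  extract {m = m} wr = ∀T-Fin N belt? >>= λ belts → WithBelts.cells belts m >>= λ (tab , cs) →
    WithBelts.WithCells.simulation belts m tab cs wr

-- Optimal responses and convergence of the game approximants.

module Convergence (G : Game) (A : Set₁) where
  open Game G
  open Classical A
  open Approximants G A

  -- In `isNorm` the optimal gain `h − g` is given by a response from `g` to `h` that attains it; by
  -- `shift` it is attained from every counter at least `g`. Comparisons are additive to stay in ℕ.
  data OptionSpec (r : Fin N) (μ : Fin (moves r)) (r′ : Fin N) : Set₁ where
    isNone : (∀ {n n′} → Rsp r μ r′ n n′ → A) → OptionSpec r μ r′
    isJump : ∀ g → Unbounded r μ r′ g → OptionSpec r μ r′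
    isNorm : ∀ g h → Rsp r μ r′ g h → (∀ {n n′} → Rsp r μ r′ n n′ → n′ ℕ.+ g ℕ.≤ h ℕ.+ n ⊎ A) → OptionSpec r μ r′

  optionSpec : ∀ r μ r′ → T (OptionSpec r μ r′)
  optionSpec r μ r′ = lem (Σ ℕ (Unbounded r μ r′)) >>= λ
    { (inj₁ (g , un)) → return (isJump g un)
    ; (inj₂ ¬un) → lem (Σ ℕ λ n → Σ ℕ λ n′ → Rsp r μ r′ n n′) >>= λ
      { (inj₂ ¬ρ) → return (isNone λ ρ → ¬ρ (_ , _ , ρ))
      ; (inj₁ (n , n′ , ρ)) → best ¬un (n ℕ.+ K) n n′ ρ (ℕ.m≤n+m _ n′) } }
    where
    -- By `gain` no response gains more than `K`, and every improvement raises `h − g` by at least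
    -- one, so `fuel` bounds the number of improvements.
    best : (Σ ℕ (Unbounded r μ r′) → A) → ∀ fuel g h → Rsp r μ r′ g h → g ℕ.+ K ℕ.≤ h ℕ.+ fuel → T (OptionSpec r μ r′)
    best ¬un fuel g h ρ enough = lem (Σ ℕ λ n → Σ ℕ λ n′ → Rsp r μ r′ n n′ × h ℕ.+ n ℕ.< n′ ℕ.+ g) >>= λ
      { (inj₂ ¬better) → return (isNorm g h ρ λ {n} {n′} ρ′ →
          [ inj₁ , (λ lt → inj₂ (¬better (n , n′ , ρ′ , lt))) ]′ (ℕ.≤-<-connex (n′ ℕ.+ g) (h ℕ.+ n)))
      ; (inj₁ (n , n′ , ρ′ , lt)) → improve fuel enough n n′ ρ′ lt }
      where
      improve : ∀ fuel → g ℕ.+ K ℕ.≤ h ℕ.+ fuel → ∀ n n′ → Rsp r μ r′ n n′ → h ℕ.+ n ℕ.< n′ ℕ.+ g → T (OptionSpec r μ r′)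
      improve zero enough n n′ ρ′ lt κ with gain ρ′
      ... | inj₂ un = ¬un (n , un)
      ... | inj₁ le = ⊥-elim (ℕ.<⇒≱ lt (begin
        n′ ℕ.+ g           ≤⟨ ℕ.+-monoˡ-≤ g le ⟩
        n ℕ.+ K ℕ.+ g     ≡⟨ go n K g ⟩
        g ℕ.+ K ℕ.+ n     ≤⟨ ℕ.+-monoˡ-≤ n enough ⟩
        h ℕ.+ 0 ℕ.+ n     ≡⟨ cong (ℕ._+ n) (ℕ.+-identityʳ h) ⟩
        h ℕ.+ n            ∎))
        where
        open ℕ.≤-Reasoning
        go : ∀ n k g → n ℕ.+ k ℕ.+ g ≡ g ℕ.+ k ℕ.+ n
        go = ℕ.solve-∀
      improve (suc fuel) enough n n′ ρ′ lt = best ¬un fuel n n′ ρ′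
        (ℕ.+-cancelˡ-≤ (suc (h ℕ.+ g)) _ _ (subst₂ ℕ._≤_ (go₁ h n g K) (go₂ n′ g h fuel) (ℕ.+-mono-≤ lt enough)))
        where
        go₁ : ∀ h n g k → suc (h ℕ.+ n) ℕ.+ (g ℕ.+ k) ≡ suc (h ℕ.+ g) ℕ.+ (n ℕ.+ k)
        go₁ = ℕ.solve-∀
        go₂ : ∀ n g h f → n ℕ.+ g ℕ.+ (h ℕ.+ suc f) ≡ suc (h ℕ.+ g) ℕ.+ (n ℕ.+ f)
        go₂ = ℕ.solve-∀

  size : ∀ {r μ r′} → OptionSpec r μ r′ → ℕ
  size (isNone _)       = 0
  size (isJump g _)     = g
  size (isNorm g h _ _) = h ℕ.+ g

  option : ∀ {r μ r′} → OptionSpec r μ r′ → Option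
  option (isNone _)       = none
  option (isJump _ _)     = jump
  option (isNorm g h _ _) = norm (+ h ℤ.- + g)

  FinSpec : Rel₁ → Fin N → Set₁
  FinSpec W r = (∀ m → T (Σ ℕ (W r m))) ⊎ Σ ℕ λ M → ∀ m n → M ℕ.≤ m → W r m n → A

  finSpec : ∀ W → Closed W → ∀ r → T (FinSpec W r)
  finSpec W cl r = lem (Σ ℕ λ m → ∀ n → W r m n → A) >>= λ
    { (inj₁ (m , ¬w)) → return (inj₂ (m , λ _ _ le wr → ¬w _ (cl le ℕ.≤-refl wr)))
    ; (inj₂ ¬m) → return (inj₁ λ m κ → ¬m (m , λ n wr → κ (n , wr))) }

  module Build (W : Rel₁) (W-closed : Closed W) (W-sim : W ⊆ F W)
               (W-greatest : (R : Rel₁) → R ⊆ F (λ r m n → R r m n ⊎ W r m n) → R ⊆ W)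
               (os : ∀ r μ r′ → OptionSpec r μ r′) (fs : ∀ r → FinSpec W r) where

    Z : ℕ
    Z = maxF λ r → maxF λ μ → maxF λ r′ → size (os r μ r′)

    size≤Z : ∀ r μ r′ → size (os r μ r′) ℕ.≤ Z
    size≤Z r μ r′ = ℕ.≤-trans (≤maxF (λ r′ → size (os r μ r′)) r′)
      (ℕ.≤-trans (≤maxF (λ μ → maxF λ r′ → size (os r μ r′)) μ) (≤maxF (λ r → maxF λ μ → maxF λ r′ → size (os r μ r′)) r))

    isFin : ∀ {r} → FinSpec W r → Bool
    isFin (inj₁ _) = true
    isFin (inj₂ _) = false

    threshold : ∀ {r} → FinSpec W r → ℕ
    threshold (inj₁ _)       = 0
    threshold (inj₂ (M , _)) = M

    fin-true : ∀ {r} (s : FinSpec W r) → isFin s ≡ true → ∀ m → T (Σ ℕ (W r m))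
    fin-true (inj₁ h) _ = h

    fin-false : ∀ {r m n} (s : FinSpec W r) → isFin s ≡ false → threshold s ℕ.≤ m → W r m n → A
    fin-false (inj₂ (M , h)) _ = h _ _

    opt-bound : ∀ {r μ r′} (s : OptionSpec r μ r′) {β} → option s ≡ norm β → ∣ β ∣ ℕ.≤ size s
    opt-bound (isNorm g h _ _) refl = ℤ.∣i-j∣≤∣i∣+∣j∣ (+ h) (+ g)

    opt-none : ∀ {r μ r′ n n′} (s : OptionSpec r μ r′) → option s ≡ none → Rsp r μ r′ n n′ → A
    opt-none (isNone h) _ = h

    opt-jump : ∀ {r μ r′ n} (s : OptionSpec r μ r′) → option s ≡ jump → size s ℕ.≤ n → Unbounded r μ r′ n
    opt-jump (isJump g un) _ le = unbounded-mono le un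

    opt-norm : ∀ {r μ r′ n β} (s : OptionSpec r μ r′) → option s ≡ norm β → size s ℕ.≤ n →
               Σ ℕ λ n′ → Rsp r μ r′ n n′ × + n′ ≡ + n ℤ.+ β
    opt-norm {n = n} (isNorm g h ρ _) refl le with shift-≤ (ℕ.≤-trans (ℕ.m≤n+m g h) le) ρ
    ... | n′ , ρ′ , eq , _ = n′ , ρ′ , trans (go (+ n′) (+ g)) (trans (cong (λ z → + z ℤ.- + g) (sym eq)) (go′ (+ n) (+ h) (+ g)))
      where
      go : ∀ a g → a ≡ a ℤ.+ g ℤ.- g
      go = solve-∀
      go′ : ∀ n h g → n ℤ.+ h ℤ.- g ≡ n ℤ.+ (h ℤ.- g)
      go′ = solve-∀

    opt-best : ∀ {r μ r′ n n′ β} (s : OptionSpec r μ r′) → option s ≡ norm β → Rsp r μ r′ n n′ → + n′ ℤ.≤ + n ℤ.+ β ⊎ A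
    opt-best {n = n} {n′} (isNorm g h _ best) refl ρ with best ρ
    ... | inj₂ a  = inj₂ a
    ... | inj₁ le = inj₁ (≤-by (ℤ.+≤+ le) (go (+ n) (+ n′) (+ g) (+ h)))
      where
      go : ∀ n n′ g h → n ℤ.+ (h ℤ.- g) ℤ.- n′ ≡ h ℤ.+ n ℤ.- (n′ ℤ.+ g)
      go = solve-∀

    arena : Arena G A
    arena = record
      { W = W ; W-closed = W-closed ; W-sim = W-sim ; W-greatest = W-greatest
      ; fin = λ r → isFin (fs r)
      ; M = maxF (λ r → threshold (fs r))
      ; fin-true = λ {r} → fin-true (fs r)
      ; fin-false = λ {r} e le → fin-false (fs r) e (ℕ.≤-trans (≤maxF (λ r → threshold (fs r)) r) le)
      ; opt = λ r μ r′ → option (os r μ r′)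
      ; g = Z ; B = Z
      ; opt-bound = λ r μ r′ e → ℕ.≤-trans (opt-bound (os r μ r′) e) (size≤Z r μ r′)
      ; opt-none = λ {r} {μ} {r′} → opt-none (os r μ r′)
      ; opt-jump = λ {r} {μ} {r′} e le → opt-jump (os r μ r′) e (ℕ.≤-trans (size≤Z r μ r′) le)
      ; opt-norm = λ {r} {μ} {r′} e le → opt-norm (os r μ r′) e (ℕ.≤-trans (size≤Z r μ r′) le)
      ; opt-best = λ {r} {μ} {r′} → opt-best (os r μ r′) }

  converges : ∀ {r m n} → (∀ k j → Apx k j r m n) → T (Σ (Fin N → ℕ → ℕ → Set) λ R → Sim R × R r m n)
  converges x = stable-level >>= λ (k , stable) → let open StableLevel k stable in
    ∀T-Fin N (λ r → ∀T-Fin (moves r) λ μ → ∀T-Fin N (optionSpec r μ)) >>= λ os →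
    ∀T-Fin N (finSpec W W-closed) >>= λ fs →
    -- `Apx (suc k) 0` is the winning region `W` of the stable level.
    Extraction.extract G A (Build.arena W W-closed W-sim W-greatest os fs) (x (suc k) 0)

-- The game of two one-counter nets.

apply-up : ∀ {d m n} i → Apply d m n → Apply d (i ℕ.+ m) (i ℕ.+ n)
apply-up {d} {m} {n} i ap = subst₂ (Apply d) (ℕ.+-comm m i) (ℕ.+-comm n i) (apply-shift i ap)

apply-suc : ∀ {d m n} → Apply d m n → n ℕ.≤ suc m
apply-suc app-dec = ℕ.≤-trans (ℕ.n≤1+n _) (ℕ.n≤1+n _)
apply-suc app-zer = ℕ.n≤1+n _
apply-suc app-inc = ℕ.≤-refl

module Union {nA : ℕ} (τ : Fin nA) (N₁ N₂ : OCN nA) where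
  open WeakSim τ N₁ N₂

  St : Set
  St = Fin (states N₁) ⊎ Fin (states N₂)

  mk : St → ℕ → C
  mk (inj₁ p) n = inj₁ (p , n)
  mk (inj₂ p) n = inj₂ (p , n)

  st : C → St
  st (inj₁ (p , _)) = inj₁ p
  st (inj₂ (p , _)) = inj₂ p

  ct : C → ℕ
  ct (inj₁ (_ , n)) = n
  ct (inj₂ (_ , n)) = n

  mk-st-ct : ∀ c → mk (st c) (ct c) ≡ c
  mk-st-ct (inj₁ _) = refl
  mk-st-ct (inj₂ _) = refl

  ct-mk : ∀ x n → ct (mk x n) ≡ n
  ct-mk (inj₁ _) n = refl
  ct-mk (inj₂ _) n = refl

  up : ℕ → C → C
  up i (inj₁ (p , n)) = inj₁ (p , i ℕ.+ n)
  up i (inj₂ (p , n)) = inj₂ (p , i ℕ.+ n)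

  up-mk : ∀ i x n → up i (mk x n) ≡ mk x (i ℕ.+ n)
  up-mk i (inj₁ _) n = refl
  up-mk i (inj₂ _) n = refl

  step-up : ∀ i {s a t} → s —[ a ]→ t → up i s —[ a ]→ up i t
  step-up i (left  (step e ap)) = left  (step e (apply-up i ap))
  step-up i (right (step e ap)) = right (step e (apply-up i ap))

  τ*-up : ∀ i {s t} → τ* s t → τ* (up i s) (up i t)
  τ*-up i = gmap (up i) (step-up i)

  ⇒-up : ∀ i {s a t} → s ⇒[ a ] t → up i s ⇒[ a ] up i t
  ⇒-up i (silent p)            = silent (τ*-up i p)
  ⇒-up i (visible a≢τ p x q)   = visible a≢τ (τ*-up i p) (step-up i x) (τ*-up i q)

  step-ct : ∀ {s a t} → s —[ a ]→ t → ct t ℕ.≤ suc (ct s)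
  step-ct (left  (step _ ap)) = apply-suc ap
  step-ct (right (step _ ap)) = apply-suc ap

  -- The counter rises by at most one per silent step, so the run passes through every intermediate
  -- level.
  cut : ∀ {s t} → τ* s t → ∀ l → ct s ℕ.≤ l → l ℕ.≤ ct t → Σ St λ x → τ* s (mk x l) × τ* (mk x l) t
  cut {s} p l lo hi with ℕ.m≤n⇒m<n∨m≡n lo
  ... | inj₂ refl = st s , subst (τ* s) (sym (mk-st-ct s)) ε , subst (λ z → τ* z _) (sym (mk-st-ct s)) p
  cut ε l lo hi | inj₁ lt = ⊥-elim (ℕ.<⇒≱ lt hi)
  cut (e ◅ p) l lo hi | inj₁ lt with cut p l (ℕ.≤-trans (step-ct e) lt) hi
  ... | x , q , q′ = x , e ◅ q , q′

  record Climb (s t : C) (k n : ℕ) : Set where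
    field
      at    : Fin k → St
      enter : ∀ i → τ* s (mk (at i) (toℕ i ℕ.+ n))
      leave : ∀ i → τ* (mk (at i) (toℕ i ℕ.+ n)) t
      rise  : ∀ {i j} → toℕ i ℕ.< toℕ j → τ* (mk (at i) (toℕ i ℕ.+ n)) (mk (at j) (toℕ j ℕ.+ n))

  climb : ∀ k {s t n} → τ* s t → ct s ℕ.≤ n → k ℕ.+ n ℕ.≤ suc (ct t) → Climb s t k n
  climb zero    p lo hi = record { at = λ () ; enter = λ () ; leave = λ () ; rise = λ { {()} } }
  climb (suc k) {s} {t} {n} p lo (s≤s hi) with cut p n lo (ℕ.≤-trans (ℕ.m≤n+m n k) hi)
  ... | x , p₁ , p₂ with climb k {mk x n} {t} {suc n} p₂ (ℕ.≤-trans (ℕ.≤-reflexive (ct-mk x n)) (ℕ.n≤1+n n)) (subst (ℕ._≤ suc (ct t)) (sym (ℕ.+-suc k n)) (s≤s hi))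
  ... | c = record { at = at′ ; enter = enter′ ; leave = leave′ ; rise = λ {i} {j} → rise′ i j }
    where
    open Climb c
    at′ : Fin (suc k) → St
    at′ zero    = x
    at′ (suc i) = at i
    lvl : ∀ i → mk (at i) (toℕ i ℕ.+ suc n) ≡ mk (at i) (suc (toℕ i ℕ.+ n))
    lvl i = cong (mk (at i)) (ℕ.+-suc (toℕ i) n)
    enter′ : ∀ i → τ* s (mk (at′ i) (toℕ i ℕ.+ n))
    enter′ zero    = p₁
    enter′ (suc i) = p₁ ◅◅ subst (τ* (mk x n)) (lvl i) (enter i)
    leave′ : ∀ i → τ* (mk (at′ i) (toℕ i ℕ.+ n)) t
    leave′ zero    = p₂
    leave′ (suc i) = subst (λ z → τ* z t) (lvl i) (leave i)
    rise′ : ∀ i j → toℕ i ℕ.< toℕ j → τ* (mk (at′ i) (toℕ i ℕ.+ n)) (mk (at′ j) (toℕ j ℕ.+ n))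
    rise′ zero    (suc j) _        = subst (τ* (mk x n)) (lvl j) (enter j)
    rise′ (suc i) (suc j) (s≤s lt) = subst₂ τ* (lvl i) (lvl j) (rise lt)

  S : ℕ
  S = states N₁ ℕ.+ states N₂

  encode : St → Fin S
  encode = join (states N₁) (states N₂)

  decode : Fin S → St
  decode = splitAt (states N₁)

  decode-encode : ∀ x → decode (encode x) ≡ x
  decode-encode = Fin.splitAt-join (states N₁) (states N₂)

  Pumps : C → Fin nA → C → Set
  Pumps s a t = ∀ i → Σ ℕ λ k → i ℕ.≤ k × s ⇒[ a ] up k t

  repeat : ∀ {x l d} → τ* (mk x l) (mk x (d ℕ.+ l)) → ∀ k → τ* (mk x l) (mk x (k ℕ.* d ℕ.+ l))
  repeat p zero = ε
  repeat {x} {l} {d} p (suc k) = repeat p k ◅◅ subst₂ τ* (up-mk (k ℕ.* d) x l)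
    (trans (up-mk (k ℕ.* d) x (d ℕ.+ l)) (cong (mk x) (go (k ℕ.* d) d l))) (τ*-up (k ℕ.* d) p)
    where
    go : ∀ a d l → a ℕ.+ (d ℕ.+ l) ≡ d ℕ.+ a ℕ.+ l
    go = ℕ.solve-∀

  -- A silent run that gains S visits some state at two levels, and the run in between can be iterated.
  pump : ∀ {s t} → τ* s t → ct s ℕ.+ S ℕ.≤ ct t → ∀ i → Σ ℕ λ k → i ℕ.≤ k × τ* s (up k t)
  pump {s} {t} p le i with climb (suc S) p ℕ.≤-refl (s≤s (subst (ℕ._≤ ct t) (ℕ.+-comm (ct s) S) le))
  ... | c with Fin.pigeonhole (ℕ.n<1+n S) (λ i → encode (Climb.at c i))
  ... | a , b , a<b , eq = i ℕ.* d , ℕ.m≤m*n i d , enter a ◅◅ repeat cyc i ◅◅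
        subst (λ z → τ* z (up (i ℕ.* d) t)) (up-mk (i ℕ.* d) (at a) (toℕ a ℕ.+ ct s)) (τ*-up (i ℕ.* d) (leave a))
    where
    open Climb c
    d : ℕ
    d = suc (toℕ b ℕ.∸ suc (toℕ a))
    same : at b ≡ at a
    same = trans (sym (decode-encode (at b))) (trans (cong decode (sym eq)) (decode-encode (at a)))
    lvl : toℕ b ℕ.+ ct s ≡ d ℕ.+ (toℕ a ℕ.+ ct s)
    lvl = trans (cong (ℕ._+ ct s) (sym (ℕ.m∸n+n≡m a<b))) (go (toℕ b ℕ.∸ suc (toℕ a)) (toℕ a) (ct s))
      where
      go : ∀ e a c → e ℕ.+ suc a ℕ.+ c ≡ suc e ℕ.+ (a ℕ.+ c)
      go = ℕ.solve-∀
    cyc : τ* (mk (at a) (toℕ a ℕ.+ ct s)) (mk (at a) (d ℕ.+ (toℕ a ℕ.+ ct s)))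
    cyc = subst (τ* (mk (at a) (toℕ a ℕ.+ ct s))) (cong₂ mk same lvl) (rise a<b)

  -- A weak step has at most two silent parts and one visible step, which gains at most 1. Beyond
  -- this bound one of the silent parts gains at least `S` and can be pumped.
  gain-bound : ℕ
  gain-bound = suc (S ℕ.+ S)

  ⇒-gain : ∀ {s a t} → s ⇒[ a ] t → ct t ℕ.≤ ct s ℕ.+ gain-bound ⊎ Pumps s a t
  ⇒-gain {s} {_} {t} (silent p) with ℕ.≤-<-connex (ct t) (ct s ℕ.+ gain-bound)
  ... | inj₁ le = inj₁ le
  ... | inj₂ lt = inj₂ λ i → let (k , i≤k , q) = pump p (ℕ.≤-trans (ℕ.+-monoʳ-≤ (ct s) (ℕ.m≤n⇒m≤1+n (ℕ.m≤m+n S S))) (ℕ.<⇒≤ lt)) i in k , i≤k , silent q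
  ⇒-gain {s} {a} {t} (visible {s₁ = s₁} {t₁} a≢τ p x q) with ℕ.≤-total (ct s ℕ.+ S) (ct s₁) | ℕ.≤-<-connex (ct t) (ct s ℕ.+ gain-bound)
  ... | _       | inj₁ le = inj₁ le
  ... | inj₁ le | inj₂ _  = inj₂ λ i → let (k , i≤k , p′) = pump p le i in k , i≤k , visible a≢τ p′ (step-up k x) (τ*-up k q)
  ... | inj₂ ge | inj₂ lt = inj₂ λ i → let (k , i≤k , q′) = pump q le i in k , i≤k , visible a≢τ p x q′
    where
    open ℕ.≤-Reasoning
    go : ∀ c s → suc (c ℕ.+ s) ℕ.+ s ≡ c ℕ.+ suc (s ℕ.+ s)
    go = ℕ.solve-∀
    le : ct t₁ ℕ.+ S ℕ.≤ ct t
    le = begin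
      ct t₁ ℕ.+ S              ≤⟨ ℕ.+-monoˡ-≤ S (ℕ.≤-trans (step-ct x) (s≤s ge)) ⟩
      suc (ct s ℕ.+ S) ℕ.+ S  ≡⟨ go (ct s) S ⟩
      ct s ℕ.+ gain-bound      ≤⟨ ℕ.<⇒≤ lt ⟩
      ct t                      ∎

  Transition : Set
  Transition = Fin nA × Eff × St

  outgoing : ∀ {s} → (Fin s → St) → List (Fin s × Fin nA × Eff × Fin s) → Fin s → List Transition
  outgoing f [] i = []
  outgoing f ((p , a , d , q) ∷ l) i with p Fin.≟ i
  ... | yes _ = (a , d , f q) ∷ outgoing f l i
  ... | no _  = outgoing f l i

  outgoing⁺ : ∀ {s} (f : Fin s → St) l {p a d q} → (p , a , d , q) ∈ l → (a , d , f q) ∈ outgoing f l p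
  outgoing⁺ f ((p , _) ∷ l) {p = i} e with p Fin.≟ i
  outgoing⁺ f _ (here refl) | yes _  = here refl
  outgoing⁺ f _ (here refl) | no ≢   = ⊥-elim (≢ refl)
  outgoing⁺ f (_ ∷ l) (there e) | yes _ = there (outgoing⁺ f l e)
  outgoing⁺ f (_ ∷ l) (there e) | no _  = outgoing⁺ f l e

  outgoing⁻ : ∀ {s} (f : Fin s → St) l i {a d y} → (a , d , y) ∈ outgoing f l i → Σ (Fin s) λ q → y ≡ f q × (i , a , d , q) ∈ l
  outgoing⁻ f ((p , a , d , q) ∷ l) i e with p Fin.≟ i
  outgoing⁻ f ((p , a , d , q) ∷ l) i (here refl) | yes refl = q , refl , here refl
  outgoing⁻ f (_ ∷ l) i (there e) | yes _ with outgoing⁻ f l i e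
  ... | q , eq , e′ = q , eq , there e′
  outgoing⁻ f (_ ∷ l) i e | no _ with outgoing⁻ f l i e
  ... | q , eq , e′ = q , eq , there e′

  trs : St → List Transition
  trs (inj₁ p) = outgoing inj₁ (OCN.δ N₁) p
  trs (inj₂ p) = outgoing inj₂ (OCN.δ N₂) p

  step⁺ : ∀ x {a d y m m′} → (a , d , y) ∈ trs x → Apply d m m′ → mk x m —[ a ]→ mk y m′
  step⁺ (inj₁ p) e ap with outgoing⁻ inj₁ (OCN.δ N₁) p e
  ... | q , refl , e′ = left (step e′ ap)
  step⁺ (inj₂ p) e ap with outgoing⁻ inj₂ (OCN.δ N₂) p e
  ... | q , refl , e′ = right (step e′ ap)

  step⁻ : ∀ x {m a t} → mk x m —[ a ]→ t →
          Σ Eff λ d → Σ St λ y → Σ ℕ λ m′ → (a , d , y) ∈ trs x × Apply d m m′ × t ≡ mk y m′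
  step⁻ (inj₁ p) (left  (step e ap)) = _ , _ , _ , outgoing⁺ inj₁ (OCN.δ N₁) e , ap , refl
  step⁻ (inj₂ p) (right (step e ap)) = _ , _ , _ , outgoing⁺ inj₂ (OCN.δ N₂) e , ap , refl

  lft rgt : Fin (S ℕ.* S) → St
  lft r = decode (proj₁ (remQuot {S} S r))
  rgt r = decode (proj₂ (remQuot {S} S r))

  pair : St → St → Fin (S ℕ.* S)
  pair x y = combine (encode x) (encode y)

  lft-pair : ∀ x y → lft (pair x y) ≡ x
  lft-pair x y = trans (cong (λ z → decode (proj₁ z)) (Fin.remQuot-combine {S} {S} (encode x) (encode y))) (decode-encode x)

  rgt-pair : ∀ x y → rgt (pair x y) ≡ y
  rgt-pair x y = trans (cong (λ z → decode (proj₂ z)) (Fin.remQuot-combine {S} {S} (encode x) (encode y))) (decode-encode y)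

  -- The first component of the new pair is forced by Spoiler's move; Duplicator chooses only the
  -- second one and its counter.
  Reply : Transition → St → St → St → ℕ → ℕ → Set
  Reply (a , d , y) z x′ z′ n n′ = x′ ≡ y × mk z n ⇒[ a ] mk z′ n′

  reply-shift : ∀ tr {z x′ z′ n n′} i → Reply tr z x′ z′ n n′ → Reply tr z x′ z′ (i ℕ.+ n) (i ℕ.+ n′)
  reply-shift (a , _) {z} {_} {z′} {n} {n′} i (eq , w) = eq , subst₂ (_⇒[ a ]_) (up-mk i z n) (up-mk i z′ n′) (⇒-up i w)

  reply-gain : ∀ tr {z x′ z′ n n′} → Reply tr z x′ z′ n n′ →
               n′ ℕ.≤ n ℕ.+ gain-bound ⊎ (∀ i → Σ ℕ λ k → i ℕ.≤ k × Reply tr z x′ z′ n k)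
  reply-gain (a , _) {z} {_} {z′} {n} {n′} (eq , w) with ⇒-gain w
  ... | inj₁ le = inj₁ (subst₂ (λ u v → u ℕ.≤ v ℕ.+ gain-bound) (ct-mk z′ n′) (ct-mk z n) le)
  ... | inj₂ pu = inj₂ λ i → let (k , i≤k , w′) = pu i in
        k ℕ.+ n′ , ℕ.≤-trans i≤k (ℕ.m≤m+n k n′) , eq , subst (mk z n ⇒[ a ]_) (up-mk k z′ n′) w′

  game : Game
  game = record
    { N     = S ℕ.* S
    ; moves = λ r → length (trs (lft r))
    ; eff   = λ r μ → proj₁ (proj₂ (List.lookup (trs (lft r)) μ))
    ; Rsp   = λ r μ r′ → Reply (List.lookup (trs (lft r)) μ) (rgt r) (lft r′) (rgt r′)
    ; shift = λ {r} {μ} → reply-shift (List.lookup (trs (lft r)) μ)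
    ; K     = gain-bound
    ; gain  = λ {r} {μ} → reply-gain (List.lookup (trs (lft r)) μ) }

  open Game game using (Sim)

  module _ (A : Set₁) where
    module 𝔸 = Approximants game A
    open Classical A

    mutual
      below⇒ : ∀ k r m n → Below k (mk (lft r) m) (mk (rgt r) n) → 𝔸.Below k r m n
      below⇒ zero    r m n _       = lift tt
      below⇒ (suc k) r m n (b , f) = below⇒ k r m n b , λ j → approx⇒ k j r m n (f j)

      approx⇒ : ∀ k j r m n → Approx k j (mk (lft r) m) (mk (rgt r) n) → 𝔸.Apx k j r m n
      approx⇒ k zero    r m n b = below⇒ k r m n b
      approx⇒ k (suc j) r m n f μ {m′} ap with List.lookup (trs (lft r)) μ | ∈-lookup {xs = trs (lft r)} μ
      ... | a , d , y | e with f a (mk y m′) (step⁺ (lft r) e ap)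
      ... | t′ , w , x = return (r′ , ct t′ , (lft-pair y (st t′) , subst (mk (rgt r) n ⇒[ a ]_) t′≡ w) ,
            approx⇒ k j r′ m′ (ct t′) (subst₂ (Approx k j) (cong (λ z → mk z m′) (sym (lft-pair y (st t′)))) t′≡ x))
        where
        r′ : Fin (S ℕ.* S)
        r′ = pair y (st t′)
        t′≡ : t′ ≡ mk (rgt r′) (ct t′)
        t′≡ = trans (sym (mk-st-ct t′)) (cong (λ z → mk z (ct t′)) (sym (rgt-pair y (st t′))))

  ⊑-from-Sim : ∀ R → Sim R → ∀ {r m n} → R r m n → mk (lft r) m ⊑ mk (rgt r) n
  ⊑-from-Sim R sim x = R̂ , R̂-sim , (_ , _ , _ , refl , refl , x)
    where
    R̂ : Rel
    R̂ s s′ = Σ (Fin (S ℕ.* S)) λ r → Σ ℕ λ m → Σ ℕ λ n → s ≡ mk (lft r) m × s′ ≡ mk (rgt r) n × R r m n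
    R̂-sim : IsWeakSimulation R̂
    R̂-sim _ _ (r , m , n , refl , refl , x) a t e with step⁻ (lft r) e
    ... | d , y , m′ , tr∈ , ap , refl with sim r m n x (index tr∈) m′ (subst (λ z → Apply (proj₁ (proj₂ z)) m m′) (lookup-index tr∈) ap)
    ... | r′ , n′ , ρ , x′ with subst (λ z → Reply z (rgt r) (lft r′) (rgt r′) n n′) (sym (lookup-index tr∈)) ρ
    ... | refl , w = mk (rgt r′) n′ , w , (r′ , m′ , n′ , refl , refl , x′)

  ApproxOmega²⇒⊑ : ∀ s s′ → ApproxOmega² s s′ → s ⊑ s′
  ApproxOmega²⇒⊑ s s′ x = Convergence.converges game (s ⊑ s′)
      (λ k j → approx⇒ (s ⊑ s′) k j r (ct s) (ct s′) (subst₂ (Approx k j) (sym s≡) (sym s′≡) (x k j)))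
      λ (R , sim , y) → subst₂ _⊑_ s≡ s′≡ (⊑-from-Sim R sim y)
    where
    r : Fin (S ℕ.* S)
    r = pair (st s) (st s′)
    s≡ : mk (lft r) (ct s) ≡ s
    s≡ = trans (cong (λ z → mk z (ct s)) (lft-pair (st s) (st s′))) (mk-st-ct s)
    s′≡ : mk (rgt r) (ct s′) ≡ s′
    s′≡ = trans (cong (λ z → mk z (ct s′)) (rgt-pair (st s) (st s′))) (mk-st-ct s′)

  module _ {R : Rel} (sim : IsWeakSimulation R) where
    mutual
      sim⇒below : ∀ k {s s′} → R s s′ → Below k s s′
      sim⇒below zero    _ = tt
      sim⇒below (suc k) x = sim⇒below k x , λ j → sim⇒approx k j x

      sim⇒approx : ∀ k j {s s′} → R s s′ → Approx k j s s′
      sim⇒approx k zero    x = sim⇒below k x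
      sim⇒approx k (suc j) x a t e with sim _ _ x a t e
      ... | t′ , w , y = t′ , w , sim⇒approx k j y

  ⊑⇒ApproxOmega² : ∀ s s′ → s ⊑ s′ → ApproxOmega² s s′
  ⊑⇒ApproxOmega² _ _ (R , sim , x) k j = sim⇒approx sim k j x

-- Lower bound: the tower.

module WeakPrefix {nA : ℕ} (τ : Fin nA) (N₁ N₂ : OCN nA) where
  open WeakSim τ N₁ N₂

  prefix : ∀ {s s′ a t} → τ* s s′ → s′ ⇒[ a ] t → s ⇒[ a ] t
  prefix π (silent p)          = silent (π ◅◅ p)
  prefix π (visible a≢τ p x q) = visible a≢τ (π ◅◅ p) x q

  mutual
    absorb-below : ∀ k {s s′ s″} → τ* s′ s″ → Below k s s″ → Below k s s′
    absorb-below zero    π _       = tt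
    absorb-below (suc k) π (b , f) = absorb-below k π b , λ j → absorb k j π (f j)

    -- Duplicator can start his weak response with the run `π`, so moving back along silent steps
    -- preserves the rank.
    absorb : ∀ k j {s s′ s″} → τ* s′ s″ → Approx k j s s″ → Approx k j s s′
    absorb k zero    π x = absorb-below k π x
    absorb k (suc j) π x a t e with x a t e
    ... | t′ , w , y = t′ , prefix π w , y

pattern tau = zero
pattern act = suc zero

-- Spoiler repeats act forever.  Duplicator, in state q i with counter n, can answer n times
-- before he has to move on to u (i − 1), where he may pump the counter up again: the
-- configuration (q i , n) has rank ω·i + n and u i has rank ω·(i+1).
loop : OCN 2
loop = record { states = 1 ; δ = (zero , act , zer , zero) ∷ [] }

module Tower (k : ℕ) where

  u q : Fin (suc k) → Fin (suc k ℕ.+ suc k)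
  u i = i ↑ˡ suc k
  q i = suc k ↑ʳ i

  State : Set
  State = Fin (suc k ℕ.+ suc k)

  Edge : Set
  Edge = State × Fin 2 × Eff × State

  pumpᵉ stopᵉ countᵉ : Fin (suc k) → Edge
  pumpᵉ  i = u i , tau , inc , u i
  stopᵉ  i = u i , tau , zer , q i
  countᵉ i = q i , act , dec , q i

  dropᵉ : Fin k → Edge
  dropᵉ i = q (suc i) , tau , zer , u (inject₁ i)

  Pumps Stops Counts Drops : List Edge
  Pumps  = tabulate pumpᵉ
  Stops  = tabulate stopᵉ
  Counts = tabulate countᵉ
  Drops  = tabulate dropᵉ

  tower : OCN 2
  tower = record { states = suc k ℕ.+ suc k ; δ = Pumps ++ Stops ++ Counts ++ Drops }

  data Transition : Edge → Set where
    pumps  : ∀ i → Transition (pumpᵉ i)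
    stops  : ∀ i → Transition (stopᵉ i)
    counts : ∀ i → Transition (countᵉ i)
    drops  : ∀ i → Transition (dropᵉ i)

  transition⁻ : ∀ {e} → e ∈ Pumps ++ Stops ++ Counts ++ Drops → Transition e
  transition⁻ e∈ with ∈-++⁻ Pumps e∈
  ... | inj₁ e₁ with ∈-tabulate⁻ {f = pumpᵉ} e₁
  ...   | i , refl = pumps i
  transition⁻ e∈ | inj₂ e₂ with ∈-++⁻ Stops e₂
  ... | inj₁ e₁ with ∈-tabulate⁻ {f = stopᵉ} e₁
  ...   | i , refl = stops i
  transition⁻ e∈ | inj₂ e₂ | inj₂ e₃ with ∈-++⁻ Counts e₃
  ... | inj₁ e₁ with ∈-tabulate⁻ {f = countᵉ} e₁
  ...   | i , refl = counts i
  transition⁻ e∈ | inj₂ e₂ | inj₂ e₃ | inj₂ e₄ with ∈-tabulate⁻ {f = dropᵉ} e₄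
  ... | i , refl = drops i

  transition⁺ : ∀ {e} → Transition e → e ∈ Pumps ++ Stops ++ Counts ++ Drops
  transition⁺ (pumps i)  = ∈-++⁺ˡ (∈-tabulate⁺ {f = pumpᵉ} i)
  transition⁺ (stops i)  = ∈-++⁺ʳ Pumps (∈-++⁺ˡ (∈-tabulate⁺ {f = stopᵉ} i))
  transition⁺ (counts i) = ∈-++⁺ʳ Pumps (∈-++⁺ʳ Stops (∈-++⁺ˡ (∈-tabulate⁺ {f = countᵉ} i)))
  transition⁺ (drops i)  = ∈-++⁺ʳ Pumps (∈-++⁺ʳ Stops (∈-++⁺ʳ Counts (∈-tabulate⁺ {f = dropᵉ} i)))

  open WeakSim tau loop tower
  open WeakPrefix tau loop tower

  p : C
  p = inj₁ (zero , 0)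

  move : ∀ {x a d y m n} → Transition (x , a , d , y) → Apply d m n → inj₂ (x , m) —[ a ]→ inj₂ (y , n)
  move t ap = right (step (transition⁺ t) ap)

  pump : ∀ i c m → τ* (inj₂ (u i , c)) (inj₂ (u i , m ℕ.+ c))
  pump i c zero    = ε
  pump i c (suc m) = pump i c m ◅◅ move (pumps i) app-inc ◅ ε

  mutual
    q-below : ∀ v i → toℕ i ≡ v → ∀ c → Below v p (inj₂ (q i , c))
    q-below zero    i       eq c = tt
    q-below (suc v) (suc i) eq c = absorb-below (suc v) (move (drops i) app-zer ◅ ε)
      (u-below v (inject₁ i) (trans (Fin.toℕ-inject₁ i) (ℕ.suc-injective eq)) c)

    q-approx : ∀ v i → toℕ i ≡ v → ∀ n c → Approx v n p (inj₂ (q i , n ℕ.+ c))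
    q-approx v i eq zero    c = q-below v i eq c
    q-approx v i eq (suc n) c a t (left (step (here refl) app-zer)) =
      inj₂ (q i , n ℕ.+ c) , visible (λ ()) ε (move (counts i) app-dec) ε , q-approx v i eq n c

    -- The counter is pumped up by `n` before counting starts. As `n` is arbitrary, this passes the
    -- limit `ω·(v + 1)`.
    u-approx : ∀ v i → toℕ i ≡ v → ∀ n c → Approx v n p (inj₂ (u i , c))
    u-approx v i eq n c = absorb v n (pump i c n ◅◅ move (stops i) app-zer ◅ ε) (q-approx v i eq n c)

    u-below : ∀ v i → toℕ i ≡ v → ∀ c → Below (suc v) p (inj₂ (u i , c))
    u-below v i eq c = u-approx v i eq 0 c , λ n → u-approx v i eq n c

  -- With `weight`, a lexicographic rank that no silent move raises and every `act` lowers. The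
  -- counter is ignored in `u i`, where pumping increases it.
  level : State → ℕ
  level x = [ (λ i → suc (toℕ i ℕ.+ toℕ i)) , (λ i → toℕ i ℕ.+ toℕ i) ]′ (splitAt (suc k) x)

  weight : State → ℕ → ℕ
  weight x n = [ (λ _ → 0) , (λ _ → n) ]′ (splitAt (suc k) x)

  level-u : ∀ i → level (u i) ≡ suc (toℕ i ℕ.+ toℕ i)
  level-u i rewrite Fin.splitAt-↑ˡ (suc k) i (suc k) = refl

  level-q : ∀ i → level (q i) ≡ toℕ i ℕ.+ toℕ i
  level-q i rewrite Fin.splitAt-↑ʳ (suc k) (suc k) i = refl

  weight-u : ∀ i n → weight (u i) n ≡ 0
  weight-u i n rewrite Fin.splitAt-↑ˡ (suc k) i (suc k) = refl

  weight-q : ∀ i n → weight (q i) n ≡ n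
  weight-q i n rewrite Fin.splitAt-↑ʳ (suc k) (suc k) i = refl

  _≼_ _≺_ : C → C → Set
  inj₁ _ ≼ _ = ⊥
  inj₂ _ ≼ inj₁ _ = ⊥
  inj₂ (y , n) ≼ inj₂ (x , m) = level y ℕ.< level x ⊎ (level y ≡ level x × weight y n ℕ.≤ weight x m)
  inj₁ _ ≺ _ = ⊥
  inj₂ _ ≺ inj₁ _ = ⊥
  inj₂ (y , n) ≺ inj₂ (x , m) = level y ℕ.< level x ⊎ (level y ≡ level x × weight y n ℕ.< weight x m)

  τ-≼ : ∀ {c t} → inj₂ c —[ tau ]→ t → t ≼ inj₂ c
  τ-≼ (right (step e ap)) = go (transition⁻ e) ap
    where
    go : ∀ {x d y m n} → Transition (x , tau , d , y) → Apply d m n → inj₂ (y , n) ≼ inj₂ (x , m)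
    go {m = m} {n} (pumps i) _ = inj₂ (refl , ℕ.≤-reflexive (trans (weight-u i n) (sym (weight-u i m))))
    go (stops i) _ = inj₁ (subst₂ ℕ._<_ (sym (level-q i)) (sym (level-u i)) ℕ.≤-refl)
    go (drops i) _ = inj₁ (ℕ.≤-trans (ℕ.≤-reflexive (cong suc (trans (level-u (inject₁ i)) (cong (λ z → suc (z ℕ.+ z)) (Fin.toℕ-inject₁ i)))))
      (ℕ.≤-reflexive (trans (cong suc (sym (ℕ.+-suc (toℕ i) (toℕ i)))) (sym (level-q (suc i))))))

  a-≺ : ∀ {c t} → inj₂ c —[ act ]→ t → t ≺ inj₂ c
  a-≺ (right (step e ap)) = go (transition⁻ e) ap
    where
    go : ∀ {x d y m n} → Transition (x , act , d , y) → Apply d m n → inj₂ (y , n) ≺ inj₂ (x , m)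
    go (counts i) (app-dec {n}) = inj₂ (refl , ℕ.≤-reflexive (trans (cong suc (weight-q i n)) (sym (weight-q i (suc n)))))

  ≼-≺-trans : ∀ {a b c} → a ≼ b → b ≺ c → a ≺ c
  ≼-≺-trans {inj₂ _} {inj₂ _} {inj₂ _} (inj₁ x)         (inj₁ y)         = inj₁ (ℕ.<-trans x y)
  ≼-≺-trans {inj₂ _} {inj₂ _} {inj₂ _} (inj₁ x)         (inj₂ (eq , _))  = inj₁ (subst (_ ℕ.<_) eq x)
  ≼-≺-trans {inj₂ _} {inj₂ _} {inj₂ _} (inj₂ (eq , _))  (inj₁ y)         = inj₁ (subst (ℕ._< _) (sym eq) y)
  ≼-≺-trans {inj₂ _} {inj₂ _} {inj₂ _} (inj₂ (eq , x))  (inj₂ (eq′ , y)) = inj₂ (trans eq eq′ , ℕ.≤-<-trans x y)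

  ≺-≼-trans : ∀ {a b c} → a ≺ b → b ≼ c → a ≺ c
  ≺-≼-trans {inj₂ _} {inj₂ _} {inj₂ _} (inj₁ x)         (inj₁ y)         = inj₁ (ℕ.<-trans x y)
  ≺-≼-trans {inj₂ _} {inj₂ _} {inj₂ _} (inj₁ x)         (inj₂ (eq , _))  = inj₁ (subst (_ ℕ.<_) eq x)
  ≺-≼-trans {inj₂ _} {inj₂ _} {inj₂ _} (inj₂ (eq , _))  (inj₁ y)         = inj₁ (subst (ℕ._< _) (sym eq) y)
  ≺-≼-trans {inj₂ _} {inj₂ _} {inj₂ _} (inj₂ (eq , x))  (inj₂ (eq′ , y)) = inj₂ (trans eq eq′ , ℕ.<-≤-trans x y)

  τ*-≺ : ∀ {b t c} → τ* b t → b ≺ c → t ≺ c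
  τ*-≺ ε lt = lt
  τ*-≺ {inj₂ _} (e ◅ π) lt = τ*-≺ π (≼-≺-trans (τ-≼ e) lt)

  after-τ* : ∀ {b c t u} → τ* (inj₂ b) c → c —[ act ]→ t → τ* t u → u ≺ inj₂ b
  after-τ* ε x π = τ*-≺ π (a-≺ x)
  after-τ* (_◅_ {j = inj₂ _} e ρ) x π = ≺-≼-trans (after-τ* ρ x π) (τ-≼ e)

  ⇒-≺ : ∀ {c t} → inj₂ c ⇒[ act ] t → t ≺ inj₂ c
  ⇒-≺ (visible _ ρ x π) = after-τ* ρ x π

  module _ {R : Rel} (sim : IsWeakSimulation R) where

    -- Spoiler repeats `act`; by `⇒-≺` each answer lowers the lexicographic rank, hence the nested
    -- well-founded recursions on level and weight.
    losing : ∀ {l} → Acc ℕ._<_ l → ∀ x n → level x ≡ l → ¬ R p (inj₂ (x , n))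
    losing (acc rl) x n refl = counting (<-wellFounded (weight x n)) x n refl refl
      where
      counting : ∀ {w} → Acc ℕ._<_ w → ∀ y m → level y ≡ level x → weight y m ≡ w → ¬ R p (inj₂ (y , m))
      counting (acc rw) y m el refl r with sim _ _ r act p (left (step (here refl) app-zer))
      ... | inj₁ _ , w , _ = ⇒-≺ w
      ... | inj₂ (z , m′) , w , r′ with ⇒-≺ w
      ...   | inj₁ lt        = losing (rl (subst (level z ℕ.<_) el lt)) z m′ refl r′
      ...   | inj₂ (eq , lt) = counting (rw lt) z m′ (trans eq el) refl r′

  not-simulated : ∀ x n → ¬ (p ⊑ inj₂ (x , n))
  not-simulated x n (R , sim , r) = losing sim (<-wellFounded (level x)) x n refl r

  -- The top state has rank `ω·(k + 1)`, above every `ω·k + n`, so one tower serves all `n`.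
  approximated : ∀ n → Approx k n p (inj₂ (u (fromℕ k) , 0))
  approximated n = u-approx k (fromℕ k) (Fin.toℕ-fromℕ k) n 0

theorem5p21 : ((nA : ℕ) (τ : Fin nA) (N₁ N₂ : OCN nA) →
    ∀ s s′ → WeakSim.ApproxOmega² τ N₁ N₂ s s′ ⇔ WeakSim._⊑_ τ N₁ N₂ s s′)
    × ((k n : ℕ) →
    Σ ℕ λ nA → Σ (Fin nA) λ τ → Σ (OCN nA) λ N₁ → Σ (OCN nA) λ N₂ →
    ¬ (∀ s s′ → WeakSim.Approx τ N₁ N₂ k n s s′ ⇔ WeakSim._⊑_ τ N₁ N₂ s s′))
theorem5p21 =
  (λ nA τ N₁ N₂ s s′ → mk⇔ (Union.ApproxOmega²⇒⊑ τ N₁ N₂ s s′) (Union.⊑⇒ApproxOmega² τ N₁ N₂ s s′)) ,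
  λ k n → 2 , tau , loop , Tower.tower k , λ eq →
    Tower.not-simulated k (Tower.u k (fromℕ k)) 0
      (Equivalence.to (eq (Tower.p k) (inj₂ (Tower.u k (fromℕ k) , 0))) (Tower.approximated k n))
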